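{- Let $(G,C_5)$ be a pair, where $C_5$ is a Hamiltonian cycle of $G$ on $5$ vertices, that admits a representation and does not satisfy $(P2)$. Then (i) with the vertices labelled $0,1,2,3,4$ in the cyclic order of $C_5$ (for a suitable labelling), $E(G)=E(C_5)\cup\{\{0,2\},\{0,3\},\{1,3\},\{1,4\}\}$ (i.e., $G$ is $K_5$ minus the edge $\{2,4\}$); and (ii) $(G,C_5)$ has a unique minimal representation, namely: $T$ has vertices $a,b,u,m,v,c,d$ and edges $au,bu,um,mv,vc,vd$, and $P_0=a\!-\!u\!-\!m\!-\!v$, $P_1=u\!-\!m\!-\!v\!-\!c$, $P_2=b\!-\!u\!-\!m$, $P_3=b\!-\!u\!-\!m\!-\!v\!-\!d$, $P_4=m\!-\!v\!-\!d$.
   Context: A representation $\langle T,\mathcal P\rangle$: a tree $T$ and a family $\mathcal P=(P_v)$ of simple paths of $T$ with at least one edge. Paths intersect if they share an edge; $\mathrm{split}(P,P')$ is the set of vertices of degree $\ge3$ in $P\cup P'$; $P\sim P'$ means they intersect and $\mathrm{split}(P,P')=\emptyset$. It represents the pair $(G,G')$ ($V(G)=V(G')$, $E(G')\subseteq E(G)$) if $uv\in E(G)$ iff $P_u,P_v$ intersect, and $uv\in E(G')$ iff $P_u\sim P_v$. Minifying operations: contracting an edge of $T$ (and of all paths using it); removing an end edge from a path. A representation is minimal if no different representation (up to isomorphism) obtainable from it by minifying operations represents the same pair. $(G,C)$ satisfies $(P2)$ if no four vertices induce $K_4$ in $G$ and a path $P_4$ in $C$. -}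

module Defs where

open import Data.Nat using (ℕ; _≤_; _≡ᵇ_)
open import Data.Bool using (Bool; true; false; _∨_; _∧_)
open import Data.Fin using (Fin; toℕ)
open import Data.List using (List; []; _∷_; _++_; [_]; length)
open import Data.Bool.ListAction using (any)
open import Data.List.Relation.Unary.Linked using (Linked)
open import Data.List.Relation.Unary.Unique.Propositional using (Unique)
open import Data.Product using (Σ; ∃; ∃₂; _×_; _,_)
open import Data.Sum using (_⊎_)
open import Relation.Nullary using (¬_)
open import Relation.Binary.PropositionalEquality using (_≡_; _≢_)
open import Relation.Binary.Construct.Closure.ReflexiveTransitive using (Star)
open import Function.Bundles using (_↔_; _⇔_; Inverse)

record SimpleGraph (n : ℕ) : Set where
  field
    adj      : Fin n → Fin n → Bool
    loopless : ∀ x → adj x x ≡ false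
    symm     : ∀ x y → adj x y ≡ adj y x

Adj : ∀ {n} → SimpleGraph n → Fin n → Fin n → Set
Adj G x y = SimpleGraph.adj G x y ≡ true

record Tree (m : ℕ) : Set where
  field
    graph     : SimpleGraph m
  E : Fin m → Fin m → Set
  E = Adj graph
  field
    connected : ∀ x y → x ≡ y ⊎ ∃ λ (l : List (Fin m)) → Linked E (x ∷ l ++ [ y ])
    acyclic   : ∀ x (l : List (Fin m)) y → l ≢ [] → Unique (x ∷ l ++ [ y ]) →
                Linked E (x ∷ l ++ [ y ]) → ¬ E y x

Consec : ∀ {A : Set} → List A → A → A → Set
Consec {A} l x y = ∃₂ λ (pre post : List A) → l ≡ pre ++ x ∷ y ∷ post

EdgeIn : ∀ {A : Set} → List A → A → A → Set
EdgeIn l x y = Consec l x y ⊎ Consec l y x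

EndEdge : ∀ {A : Set} → List A → A → A → Set
EndEdge {A} l x y = (∃ λ (rest : List A) → l ≡ x ∷ y ∷ rest)
                  ⊎ (∃ λ (pre : List A) → l ≡ pre ++ y ∷ x ∷ [])

record Path {m : ℕ} (T : Tree m) : Set where
  field
    verts  : List (Fin m)
    chain  : Linked (Tree.E T) verts
    simple : Unique verts
    long   : 2 ≤ length verts

edge : ∀ {m} {T : Tree m} → Path T → Fin m → Fin m → Set
edge P = EdgeIn (Path.verts P)

Intersect : ∀ {m} {T : Tree m} → Path T → Path T → Set
Intersect {m} P Q = ∃₂ λ (x y : Fin m) → edge P x y × edge Q x y

-- x has degree ≥ 3 in the union P ∪ Q, i.e. x ∈ split(P,Q)
InSplit : ∀ {m} {T : Tree m} → Path T → Path T → Fin m → Set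
InSplit {m} P Q x = Σ (Fin m) λ y₁ → Σ (Fin m) λ y₂ → Σ (Fin m) λ y₃ →
  y₁ ≢ y₂ × y₁ ≢ y₃ × y₂ ≢ y₃ ×
  (edge P x y₁ ⊎ edge Q x y₁) × (edge P x y₂ ⊎ edge Q x y₂) × (edge P x y₃ ⊎ edge Q x y₃)

_∼_ : ∀ {m} {T : Tree m} → Path T → Path T → Set
P ∼ Q = Intersect P Q × (∀ x → ¬ InSplit P Q x)

record Rep (n : ℕ) : Set where
  field
    m : ℕ
    T : Tree m
    P : Fin n → Path T

adjT : ∀ {n} (R : Rep n) → Fin (Rep.m R) → Fin (Rep.m R) → Bool
adjT R = SimpleGraph.adj (Tree.graph (Rep.T R))

AdjT : ∀ {n} (R : Rep n) → Fin (Rep.m R) → Fin (Rep.m R) → Set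
AdjT R = Tree.E (Rep.T R)

edgeR : ∀ {n} (R : Rep n) → Fin n → Fin (Rep.m R) → Fin (Rep.m R) → Set
edgeR R v = edge (Rep.P R v)

Represents : ∀ {n} → SimpleGraph n → SimpleGraph n → Rep n → Set
Represents {n} G G' R = ∀ (u v : Fin n) → u ≢ v →
  (Adj G u v ⇔ Intersect (Rep.P R u) (Rep.P R v)) ×
  (Adj G' u v ⇔ (Rep.P R u ∼ Rep.P R v))

Iso : ∀ {n} → Rep n → Rep n → Set
Iso {n} R R' = Σ (Fin (Rep.m R) ↔ Fin (Rep.m R')) λ σ →
  (∀ a b → adjT R' (Inverse.to σ a) (Inverse.to σ b) ≡ adjT R a b) ×
  (∀ v a b → edgeR R' v (Inverse.to σ a) (Inverse.to σ b) ⇔ edgeR R v a b)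

-- Minifying operation 1: contracting an edge xy of T (and of all paths using it).
-- f : V(T) → V(T') is the quotient map identifying exactly x and y.
Contract : ∀ {n} → Rep n → Rep n → Set
Contract {n} R R' = Σ (Fin (Rep.m R)) λ x → Σ (Fin (Rep.m R)) λ y → AdjT R x y ×
  Σ (Fin (Rep.m R) → Fin (Rep.m R')) λ f →
    (∀ b → ∃ λ a → f a ≡ b) ×
    (∀ a b → (f a ≡ f b) ⇔ (a ≡ b ⊎ (a ≡ x × b ≡ y) ⊎ (a ≡ y × b ≡ x))) ×
    (∀ a' b' → AdjT R' a' b' ⇔
       (∃₂ λ a b → f a ≡ a' × f b ≡ b' × AdjT R a b × a' ≢ b')) ×
    (∀ v a' b' → edgeR R' v a' b' ⇔
       (∃₂ λ a b → f a ≡ a' × f b ≡ b' × edgeR R v a b × a' ≢ b'))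

-- Minifying operation 2: removing an end edge {x,y} from one path P_v
-- (the tree is unchanged, up to a relabelling σ of its vertices).
RemoveEnd : ∀ {n} → Rep n → Rep n → Set
RemoveEnd {n} R R' = Σ (Fin (Rep.m R) ↔ Fin (Rep.m R')) λ σ →
  (∀ a b → adjT R' (Inverse.to σ a) (Inverse.to σ b) ≡ adjT R a b) ×
  Σ (Fin n) λ v → Σ (Fin (Rep.m R)) λ x → Σ (Fin (Rep.m R)) λ y →
    EndEdge (Path.verts (Rep.P R v)) x y ×
    (∀ w a b → edgeR R' w (Inverse.to σ a) (Inverse.to σ b) ⇔
       (edgeR R w a b × (w ≡ v → ¬ ((a ≡ x × b ≡ y) ⊎ (a ≡ y × b ≡ x)))))

Minify : ∀ {n} → Rep n → Rep n → Set
Minify R R' = Contract R R' ⊎ RemoveEnd R R'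

Minimal : ∀ {n} → SimpleGraph n → SimpleGraph n → Rep n → Set
Minimal {n} G G' R = ∀ (R' : Rep n) → Star Minify R R' → Represents G G' R' → Iso R R'

InducesK4P4 : SimpleGraph 5 → SimpleGraph 5 → Fin 5 → Fin 5 → Fin 5 → Fin 5 → Set
InducesK4P4 G C a b c d =
  (Adj G a b × Adj G a c × Adj G a d × Adj G b c × Adj G b d × Adj G c d) ×
  (Adj C a b × Adj C b c × Adj C c d × ¬ Adj C a c × ¬ Adj C b d × ¬ Adj C a d)

P2 : SimpleGraph 5 → SimpleGraph 5 → Set
P2 G C = ∀ a b c d → ¬ InducesK4P4 G C a b c d

fromEdges : ∀ {k} → List (ℕ × ℕ) → Fin k → Fin k → Bool
fromEdges es i j = any (λ { (p , q) → ((p ≡ᵇ toℕ i) ∧ (q ≡ᵇ toℕ j)) ∨ ((p ≡ᵇ toℕ j) ∧ (q ≡ᵇ toℕ i)) }) es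

stdC : Fin 5 → Fin 5 → Bool
stdC = fromEdges ((0 , 1) ∷ (1 , 2) ∷ (2 , 3) ∷ (3 , 4) ∷ (4 , 0) ∷ [])

stdG : Fin 5 → Fin 5 → Bool
stdG = fromEdges ((0 , 1) ∷ (1 , 2) ∷ (2 , 3) ∷ (3 , 4) ∷ (4 , 0) ∷
                  (0 , 2) ∷ (0 , 3) ∷ (1 , 3) ∷ (1 , 4) ∷ [])

HamCycle5 : SimpleGraph 5 → Set
HamCycle5 C = Σ (Fin 5 ↔ Fin 5) λ lab →
  ∀ i j → SimpleGraph.adj C (Inverse.to lab i) (Inverse.to lab j) ≡ stdC i j

-- The tree: a=0, b=1, u=2, m=3, v=4, c=5, d=6; edges au,bu,um,mv,vc,vd
stdTree : Fin 7 → Fin 7 → Bool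
stdTree = fromEdges ((0 , 2) ∷ (1 , 2) ∷ (2 , 3) ∷ (3 , 4) ∷ (4 , 5) ∷ (4 , 6) ∷ [])

stdPath : Fin 5 → List ℕ
stdPath Fin.zero = 0 ∷ 2 ∷ 3 ∷ 4 ∷ []
stdPath (Fin.suc Fin.zero) = 2 ∷ 3 ∷ 4 ∷ 5 ∷ []
stdPath (Fin.suc (Fin.suc Fin.zero)) = 1 ∷ 2 ∷ 3 ∷ []
stdPath (Fin.suc (Fin.suc (Fin.suc Fin.zero))) = 1 ∷ 2 ∷ 3 ∷ 4 ∷ 6 ∷ []
stdPath (Fin.suc (Fin.suc (Fin.suc (Fin.suc Fin.zero)))) = 3 ∷ 4 ∷ 6 ∷ []

IsStd : (Fin 5 ↔ Fin 5) → Rep 5 → Set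
IsStd lab R = Σ (Fin 7 ↔ Fin (Rep.m R)) λ τ →
  (∀ i j → adjT R (Inverse.to τ i) (Inverse.to τ j) ≡ stdTree i j) ×
  (∀ k i j → edgeR R (Inverse.to lab k) (Inverse.to τ i) (Inverse.to τ j) ⇔
              EdgeIn (stdPath k) (toℕ i) (toℕ j))

{-# OPTIONS --safe #-}
module Submission where

-- Work with nx a b, the first vertex after a on the path from a to b. If M ∼ Q and t is an inner
-- vertex of Q, then all of M lies, seen from t, in the two directions in which Q leaves t. Hence
-- three vertices in general position cannot have two of them on Q and the third on M: Q and M
-- would split at their median. With K₄ on 0, 1, 2, 3 this forces a split vertex U of P₀ and P₂, a
-- split vertex V of P₁ and P₃, and puts the splits of P₀, P₃ at U or V. The case V is the
-- reflection of the case U, and in the case U it follows that P₂ and P₄ are disjoint, that P₁ and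
-- P₄ split at V, and that an edge g ∈ P₁ ∩ P₂ and an edge h ∈ P₀ ∩ P₄ both separate U from V.
--
-- The edges g, h and the four edges leaving U and V off the path UV cut the tree into seven
-- connected regions. Contracting the regions and trimming the paths turns any representation into
-- the standard one, so every minimal representation is standard. Conversely, whatever is obtained
-- from the standard representation and still represents the pair has at least seven vertices, so
-- nothing was contracted, and the required intersections and splits leave no end edge to remove.

-- Paths are lists, but the conditions on them (containing an edge, splitting, separating) depend
-- only on which neighbour of a vertex leads to another vertex. Stated through `nx`, they become
-- equations between neighbours, free of orientations and positions in lists. The equations come
-- from one recurring argument: if two paths split at `t`, a path in relation `∼` to both is seen
-- from `t` only through the edge that they share, because each of them allows two directions and
-- only that one is common (`agree`). Enough such equations at three vertices contradict
-- `no-tripod`.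
--
-- The reduction carries a `Fold` as its invariant, not `Represents`: a sequence of minifying
-- operations may pass through representations of other pairs, so intersections and splits are
-- examined only once, at the standard representation. A fold passes to the quotient whenever the
-- contracted edge lies inside a fibre. Since a fold is onto, it is also the source of the lower
-- bound on the number of vertices in the minimality argument.

open import Defs
open import Data.Bool using (Bool; true; false)
import Data.Bool.Properties as Bool
open import Data.Empty using (⊥; ⊥-elim)
open import Data.Fin using (Fin; zero; suc; toℕ; punchIn; punchOut)
open import Data.Fin.Patterns using (0F; 1F; 2F; 3F; 4F; 5F; 6F)
open import Data.Fin.Properties using (_≟_; any?; all?; toℕ-injective; injective⇒≤; punchIn-punchOut; punchIn-injective; punchInᵢ≢i; punchOut-cong)
open import Data.List using (List; []; _∷_; _++_; [_]; length; map; reverse; allFin)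
open import Data.List.Properties using (++-assoc; ++-identityʳ)
import Data.List.Membership.DecPropositional as DecMembership
open import Data.List.Membership.Propositional using (_∈_; _∉_)
open import Data.List.Membership.Propositional.Properties using (∈-++⁺ʳ; ∈-++⁺ˡ; ∈-map⁻; ∈-allFin)
open import Data.List.Relation.Unary.All using ([])
open import Data.List.Relation.Unary.All.Properties using (All¬⇒¬Any; ¬Any⇒All¬; ++⁻ˡ)
open import Data.List.Relation.Unary.AllPairs using ([]; _∷_)
open import Data.List.Relation.Unary.Any using (here; there)
open import Data.List.Relation.Unary.Linked using (Linked; []; [-]; _∷_)
import Data.List.Relation.Unary.Linked as Linked
open import Data.List.Relation.Unary.Unique.Propositional using (Unique)
open import Data.Nat using (ℕ; zero; suc; _≤_; _<_; z≤n; s≤s)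
import Data.Nat.Properties as ℕ
open import Data.Product using (Σ; ∃; ∃₂; _×_; _,_; proj₁; proj₂; map₂)
open import Data.Sum using (_⊎_; inj₁; inj₂; [_,_]′; swap)
import Data.Sum as Sum
open import Function using (_∘_)
open import Function.Bundles using (_⇔_; mk⇔; _↔_; mk↔ₛ′; Inverse; Equivalence)
open import Function.Construct.Composition using (_↔-∘_)
open import Function.Construct.Identity using (↔-id)
open import Function.Construct.Symmetry using (↔-sym)
open import Relation.Binary.Construct.Closure.ReflexiveTransitive using (Star; ε; _◅_; _◅◅_)
open import Relation.Binary.Definitions using (DecidableEquality)
open import Relation.Binary.PropositionalEquality using (_≡_; _≢_; refl; sym; trans; cong; cong₂; subst; subst₂; ≢-sym)
open import Relation.Nullary using (¬_; Dec; yes; no; does; contradiction; ¬?; _×-dec_; _⊎-dec_)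
open import Relation.Nullary.Decidable using (map′; decidable-stable; dec-true; dec-false; does-⇔; from-yes; _→-dec_; False; toWitnessFalse)

-- Simple paths and their edges

data SimplePath {A : Set} (R : A → A → Set) : A → A → List A → Set where
  stop : ∀ {a} → SimplePath R a a (a ∷ [])
  step : ∀ {a b c l} → R a b → SimplePath R b c l → a ∉ l → SimplePath R a c (a ∷ l)

-- Inductive form of `EdgeIn`, which can be matched while a list is peeled from the front.
data Edge {A : Set} : List A → A → A → Set where
  fwd   : ∀ {a b l} → Edge (a ∷ b ∷ l) a b
  bwd   : ∀ {a b l} → Edge (a ∷ b ∷ l) b a
  later : ∀ {a b c l} → Edge l b c → Edge (a ∷ l) b c

module _ {A : Set} where

  Edge-sym : ∀ {l} {a b : A} → Edge l a b → Edge l b a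
  Edge-sym fwd       = bwd
  Edge-sym bwd       = fwd
  Edge-sym (later e) = later (Edge-sym e)

  Edge-∈ : ∀ {l} {a b : A} → Edge l a b → a ∈ l
  Edge-∈ fwd       = here refl
  Edge-∈ bwd       = there (here refl)
  Edge-∈ (later e) = there (Edge-∈ e)

  consec⇒Edge : ∀ pre {post} {a b : A} → Edge (pre ++ a ∷ b ∷ post) a b
  consec⇒Edge []        = fwd
  consec⇒Edge (_ ∷ pre) = later (consec⇒Edge pre)

  EdgeIn⇒Edge : ∀ {l} {a b : A} → EdgeIn l a b → Edge l a b
  EdgeIn⇒Edge (inj₁ (pre , _ , refl)) = consec⇒Edge pre
  EdgeIn⇒Edge (inj₂ (pre , _ , refl)) = Edge-sym (consec⇒Edge pre)

  Edge⇒EdgeIn : ∀ {l} {a b : A} → Edge l a b → EdgeIn l a b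
  Edge⇒EdgeIn fwd = inj₁ ([] , _ , refl)
  Edge⇒EdgeIn bwd = inj₂ ([] , _ , refl)
  Edge⇒EdgeIn (later {a = a} e) with Edge⇒EdgeIn e
  ... | inj₁ (pre , post , refl) = inj₁ (a ∷ pre , post , refl)
  ... | inj₂ (pre , post , refl) = inj₂ (a ∷ pre , post , refl)

  EdgeIn-sym : ∀ {l} {a b : A} → EdgeIn l a b → EdgeIn l b a
  EdgeIn-sym (inj₁ c) = inj₂ c
  EdgeIn-sym (inj₂ c) = inj₁ c

module _ {A : Set} {R : A → A → Set} where

  SimplePath-head : ∀ {a b l} → SimplePath R a b l → ∃ λ l′ → l ≡ a ∷ l′
  SimplePath-head stop         = _ , refl
  SimplePath-head (step _ _ _) = _ , refl

  SimplePath-last : ∀ {a b l} → SimplePath R a b l → ∃ λ l′ → l ≡ l′ ++ [ b ]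
  SimplePath-last stop = [] , refl
  SimplePath-last (step {a = a} _ p _) with SimplePath-last p
  ... | l′ , refl = a ∷ l′ , refl

  start-∈ : ∀ {a b l} → SimplePath R a b l → a ∈ l
  start-∈ stop         = here refl
  start-∈ (step _ _ _) = here refl

  end-∈ : ∀ {a b l} → SimplePath R a b l → b ∈ l
  end-∈ stop         = here refl
  end-∈ (step _ p _) = there (end-∈ p)

  SimplePath⇒Linked : ∀ {a b l} → SimplePath R a b l → Linked R l
  SimplePath⇒Linked stop = [-]
  SimplePath⇒Linked (step r p _) with SimplePath-head p
  ... | _ , refl = r ∷ SimplePath⇒Linked p

  SimplePath⇒Unique : ∀ {a b l} → SimplePath R a b l → Unique l
  SimplePath⇒Unique stop         = [] ∷ []
  SimplePath⇒Unique (step _ p new) = ¬Any⇒All¬ _ new ∷ SimplePath⇒Unique p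

  Linked⇒SimplePath : ∀ {a l} → Linked R (a ∷ l) → Unique (a ∷ l) →
                      ∃ λ b → SimplePath R a b (a ∷ l)
  Linked⇒SimplePath [-]      _        = _ , stop
  Linked⇒SimplePath (r ∷ rs) (n ∷ ns) with Linked⇒SimplePath rs ns
  ... | b , p = b , step r p (All¬⇒¬Any n)

  SimplePath-map : ∀ {B : Set} {S : B → B → Set} (f : A → B) →
    (∀ {a b} → f a ≡ f b → a ≡ b) → (∀ {a b} → R a b → S (f a) (f b)) →
    ∀ {a b l} → SimplePath R a b l → SimplePath S (f a) (f b) (map f l)
  SimplePath-map f inj hom stop = stop
  SimplePath-map f inj hom (step r p new) =
    step (hom r) (SimplePath-map f inj hom p) λ i → case (∈-map⁻ f i)
    where
    case : ∃ (λ x → x ∈ _ × _ ≡ f x) → ⊥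
    case (x , x∈ , eq) = new (subst (_∈ _) (sym (inj eq)) x∈)

-- Directions in a tree

module TreeTheory {m : ℕ} (T : Tree m) where

  open Tree T using (E; graph; connected; acyclic)
  open DecMembership (_≟_ {m}) public using (_∈?_)

  E-sym : ∀ {a b} → E a b → E b a
  E-sym {a} {b} e = trans (SimpleGraph.symm graph b a) e

  E⇒≢ : ∀ {a b} → E a b → a ≢ b
  E⇒≢ {a} e refl with trans (sym e) (SimpleGraph.loopless graph a)
  ... | ()

  Avoid : Fin m → Fin m → Fin m → Set
  Avoid x a b = E a b × a ≢ x × b ≢ x

  -- Connection in the tree without `x`, except that the empty walk exists at `x` as well; hence the
  -- separate hypotheses `x ≢ a` below.
  Joined : Fin m → Fin m → Fin m → Set
  Joined x = Star (Avoid x)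

  Joined-sym : ∀ {x a b} → Joined x a b → Joined x b a
  Joined-sym ε = ε
  Joined-sym ((e , a≢ , b≢) ◅ s) = Joined-sym s ◅◅ ((E-sym e , b≢ , a≢) ◅ ε)

  suffix : ∀ {a b c l} → SimplePath E a b l → c ∈ l →
           ∃ λ l′ → SimplePath E c b l′ × (∀ {z} → z ∈ l′ → z ∈ l)
  suffix p@stop (here refl) = _ , p , λ i → i
  suffix p@(step _ _ _) (here refl) = _ , p , λ i → i
  suffix (step _ p _) (there i) with suffix p i
  ... | l′ , q , sub = l′ , q , there ∘ sub

  eraseLoops : ∀ {x a b} → a ≢ x → Joined x a b → ∃ λ l → SimplePath E a b l × x ∉ l
  eraseLoops a≢x ε = _ , stop , λ { (here x≡a) → a≢x (sym x≡a) }
  eraseLoops {a = a} a≢x ((e , _ , c≢x) ◅ s) with eraseLoops c≢x s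
  ... | l , p , x∉l with a ∈? l
  ...   | no a∉l = a ∷ l , step e p a∉l , λ { (here x≡a) → a≢x (sym x≡a) ; (there i) → x∉l i }
  ...   | yes a∈l with suffix p a∈l
  ...     | l′ , q , sub = l′ , q , x∉l ∘ sub

  no-cycle : ∀ {x a b l} → E x a → SimplePath E a b l → x ∉ l → E x b → a ≡ b
  no-cycle {x} {a} {b} e p x∉ e′ with a ≟ b
  ... | yes a≡b = a≡b
  ... | no a≢b with SimplePath-last p | SimplePath-head p
  ...   | [] , refl | _ , refl = contradiction refl a≢b
  ...   | c ∷ l′ , refl | _ , _ =
          contradiction (E-sym e′) (acyclic x (c ∷ l′) b (λ ()) (SimplePath⇒Unique q) (SimplePath⇒Linked q))
          where q = step e p x∉

  -- Without its loops the walk is a simple path that `x` would close to a cycle. This makes the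
  -- direction from `x` to a vertex unique.
  joined-nbrs : ∀ {x a b} → E x a → E x b → Joined x a b → a ≡ b
  joined-nbrs e e′ s with eraseLoops (E⇒≢ (E-sym e)) s
  ... | _ , p , x∉ = no-cycle e p x∉ e′

  record Toward (a b : Fin m) : Set where
    field
      next   : Fin m
      nbr    : E a next
      joined : Joined a b next

  -- Follow the walk to its first visit to `a`; the vertex just before is the neighbour sought.
  walk⇒toward : ∀ {a b} l → b ≢ a → Linked E (b ∷ l ++ [ a ]) → Toward a b
  walk⇒toward [] b≢a (e ∷ _) = record { next = _ ; nbr = E-sym e ; joined = ε }
  walk⇒toward {a} (c ∷ l) b≢a (e ∷ w) with c ≟ a
  ... | yes refl = record { next = _ ; nbr = E-sym e ; joined = ε }
  ... | no c≢a = let open Toward (walk⇒toward l c≢a w) in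
        record { next = next ; nbr = nbr ; joined = (e , b≢a , c≢a) ◅ joined }

  toward : ∀ {a b} → a ≢ b → Toward a b
  toward {a} {b} a≢b with connected b a
  ... | inj₁ b≡a = contradiction (sym b≡a) a≢b
  ... | inj₂ (l , w) = walk⇒toward l (≢-sym a≢b) w

  abstract

    -- The neighbour of a on the path from a to b (junk value a if a ≡ b).
    nx : Fin m → Fin m → Fin m
    nx a b with a ≟ b
    ... | yes _  = a
    ... | no a≢b = Toward.next (toward a≢b)

    nx-spec : ∀ {a b} → a ≢ b → E a (nx a b) × Joined a b (nx a b)
    nx-spec {a} {b} a≢b with a ≟ b
    ... | yes a≡b = contradiction a≡b a≢b
    ... | no a≢b′ = Toward.nbr (toward a≢b′) , Toward.joined (toward a≢b′)

  nx-joined : ∀ {x a b} → x ≢ a → x ≢ b → Joined x a b → nx x a ≡ nx x b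
  nx-joined x≢a x≢b s with nx-spec x≢a | nx-spec x≢b
  ... | e , p | e′ , p′ = joined-nbrs e e′ (Joined-sym p ◅◅ s ◅◅ p′)

  nx-adj : ∀ {x a b} → E a b → x ≢ a → x ≢ b → nx x a ≡ nx x b
  nx-adj e x≢a x≢b = nx-joined x≢a x≢b ((e , ≢-sym x≢a , ≢-sym x≢b) ◅ ε)

  nx-nbr : ∀ {x a} → E x a → nx x a ≡ a
  nx-nbr e with nx-spec (E⇒≢ e)
  ... | e′ , p = sym (joined-nbrs e e′ p)

  private
    nx-along : ∀ {g p z} → p ≢ g → Joined g p z → nx g p ≡ nx g z
    nx-along p≢g ε = refl
    nx-along p≢g ((e , _ , q≢g) ◅ s) =
      trans (nx-adj e (≢-sym p≢g) (≢-sym q≢g)) (nx-along q≢g s)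

    reroute : ∀ {g h p z} → p ≢ g → Joined g p z → nx g z ≢ nx g h → Joined h p z
    reroute p≢g ε _ = ε
    reroute {g} {h} p≢g w@((e , _ , q≢g) ◅ s) ne =
      (e , (λ { refl → ne (sym (nx-along p≢g w)) }) , λ { refl → ne (sym (nx-along q≢g s)) })
      ◅ reroute q≢g s ne

  -- If g lies between h and v, then h sees g and v in the same direction.
  nx-between : ∀ {g h v} → g ≢ h → g ≢ v → h ≢ v → nx g h ≢ nx g v → nx h v ≡ nx h g
  nx-between {g} {h} {v} g≢h g≢v h≢v ne with nx-spec g≢v
  ... | e , s = nx-joined h≢v (≢-sym g≢h)
      (reroute (≢-sym g≢v) s (λ eq → ne (sym (trans (nx-along (≢-sym g≢v) s) eq)))
       ◅◅ (E-sym e , z≢h , g≢h) ◅ ε)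
    where
    z≢h : nx g v ≢ h
    z≢h refl = ne (nx-nbr e)

  private
    -- The walk first enters `b` from a vertex other than `a`, and everything before lies in the
    -- same direction from `b`.
    not-through : ∀ {a b p} → p ≢ b → Joined a p b → nx b p ≢ a
    not-through p≢b ε = contradiction refl p≢b
    not-through {a} {b} {p} p≢b (_◅_ {j = q} (e , p≢a , _) s) with q ≟ b
    ... | yes refl = λ eq → p≢a (trans (sym (nx-nbr (E-sym e))) eq)
    ... | no q≢b   = λ eq → not-through q≢b s (trans (sym (nx-adj e (≢-sym p≢b) (≢-sym q≢b))) eq)

  -- Side a b t: t lies in the component of b after removing the edge ab.
  Side : Fin m → Fin m → Fin m → Set
  Side a b t = t ≢ a × nx a t ≡ b

  side-excl : ∀ {a b t} → Side a b t → Side b a t → ⊥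
  side-excl {a} {b} {t} (t≢a , nx≡b) (t≢b , nx≡a) =
    not-through t≢b (subst (Joined a t) nx≡b (proj₂ (nx-spec (≢-sym t≢a)))) nx≡a

  -- If `a` does not see `t` through `b`, then `a` lies between `b` and `t`, so `b` sees `t` through
  -- `a`.
  side-total : ∀ {a b} → E a b → ∀ t → Side a b t ⊎ Side b a t
  side-total {a} {b} e t with t ≟ a | t ≟ b
  ... | yes refl | _ = inj₂ (E⇒≢ e , nx-nbr (E-sym e))
  ... | no t≢a | yes refl = inj₁ (t≢a , nx-nbr e)
  ... | no t≢a | no t≢b with nx a t ≟ b
  ...   | yes eq = inj₁ (t≢a , eq)
  ...   | no ne  = inj₂ (t≢b , trans
            (nx-between (E⇒≢ e) (≢-sym t≢a) (≢-sym t≢b) (λ eq → ne (trans (sym eq) (nx-nbr e))))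
            (nx-nbr (E-sym e)))

  side-far : ∀ {a b} → E a b → Side a b b
  side-far e = E⇒≢ (E-sym e) , nx-nbr e

  -- An edge that avoids `a` lies in a single direction from `a`, so only an edge at `a` can change
  -- sides.
  side-crossing : ∀ {a b p q} → E p q → Side a b q → ¬ Side a b p → p ≡ a × q ≡ b
  side-crossing {a} {b} {p} {q} e (q≢a , eq) ¬s with p ≟ a
  ... | yes refl = refl , trans (sym (nx-nbr e)) eq
  ... | no p≢a   = contradiction (p≢a , trans (nx-adj e (≢-sym p≢a) (≢-sym q≢a)) eq) ¬s

  abstract

    side? : ∀ a b t → Dec (Side a b t)
    side? a b t with t ≟ a | nx a t ≟ b
    ... | yes t≡a | _     = no λ s → proj₁ s t≡a
    ... | no t≢a | yes eq = yes (t≢a , eq)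
    ... | no t≢a | no ne  = no (ne ∘ proj₂)

  simplePath : ∀ a b → ∃ λ l → SimplePath E a b l
  simplePath a b with a ≟ b
  ... | yes refl = _ , stop
  ... | no a≢b with nx-spec a≢b
  ...   | e , s with eraseLoops (≢-sym (E⇒≢ e)) (Joined-sym s)
  ...     | l , p , a∉l = a ∷ l , step e p a∉l

  nx-const : ∀ {a b l t p q} → SimplePath E a b l → t ∉ l → p ∈ l → q ∈ l → nx t p ≡ nx t q
  nx-const path t∉ p∈ q∈ = trans (toStart path t∉ p∈) (sym (toStart path t∉ q∈))
    where
    toStart : ∀ {a b l t p} → SimplePath E a b l → t ∉ l → p ∈ l → nx t p ≡ nx t a
    toStart stop         t∉ (here refl) = refl
    toStart (step e p _) t∉ (here refl) = refl
    toStart (step e p _) t∉ (there i) = trans (toStart p (t∉ ∘ there) i)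
      (nx-adj (E-sym e) (λ { refl → t∉ (there (start-∈ p)) }) (λ { refl → t∉ (here refl) }))

  nx-second : ∀ {a b c l p} → E a b → SimplePath E b c l → a ∉ l → p ∈ l → nx a p ≡ b
  nx-second e p a∉ i = trans (nx-const p a∉ i (start-∈ p)) (nx-nbr e)

  -- The second vertex of either path is `nx a b`.
  SimplePath-unique : ∀ {a b l l′} → SimplePath E a b l → SimplePath E a b l′ → l ≡ l′
  SimplePath-unique stop stop = refl
  SimplePath-unique stop (step _ p new) = contradiction (end-∈ p) new
  SimplePath-unique (step _ p new) stop = contradiction (end-∈ p) new
  SimplePath-unique (step e p new) (step e′ p′ new′)
    with trans (sym (nx-second e p new (end-∈ p))) (nx-second e′ p′ new′ (end-∈ p′))
  ... | refl = cong (_ ∷_) (SimplePath-unique p p′)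

  record Median (a b c : Fin m) : Set where
    field
      mid : Fin m
      mid≢a : mid ≢ a
      mid≢b : mid ≢ b
      mid≢c : mid ≢ c
      ab : nx mid a ≢ nx mid b
      ac : nx mid a ≢ nx mid c
      bc : nx mid b ≢ nx mid c

  private
    nx-end-≢ : ∀ {t a b l} → a ≢ b → SimplePath E a b l → t ∉ l → nx a b ≢ t
    nx-end-≢ a≢b stop _ = contradiction refl a≢b
    nx-end-≢ _ (step e p new) t∉ eq =
      t∉ (there (subst (_∈ _) (trans (sym (nx-second e p new (end-∈ p))) eq) (start-∈ p)))

    -- Walk from a to b until the directions of b and c part.
    search : ∀ {a b c l} → SimplePath E a b l → a ≢ b → a ≢ c → b ≢ c →
             nx a b ≡ nx a c → nx b a ≡ nx b c → nx c a ≡ nx c b →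
             Σ (Median a b c) λ M → Median.mid M ∈ l
    search stop a≢b = contradiction refl a≢b
    search {a} {b} {c} (step {b = t} {l = l} e p a∉) a≢b a≢c b≢c atA atB atC
      with nx-second e p a∉ (end-∈ p)
    ... | ab≡t with t ≟ b
    -- If `a` and `b` were adjacent, `c` would lie on both sides of the edge between them.
    ... | yes refl = ⊥-elim (side-excl (≢-sym a≢c , trans (sym atA) ab≡t)
                       (≢-sym b≢c , trans (sym atB) (nx-nbr (E-sym e))))
    ... | no t≢b with t ≟ c
    ... | yes refl = contradiction (trans (sym atC) (nx-nbr (E-sym e))) (nx-end-≢ t≢b p a∉)
    ... | no t≢c with nx t b ≟ nx t c
    ... | no ne = record
          { mid = t ; mid≢a = ≢-sym (E⇒≢ e) ; mid≢b = t≢b ; mid≢c = t≢c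
          ; ab = λ eq → nx-end-≢ t≢b p a∉ (trans (sym eq) (nx-nbr (E-sym e)))
          ; ac = λ eq → side-excl (≢-sym a≢c , trans (sym atA) ab≡t)
                          (≢-sym t≢c , trans (sym eq) (nx-nbr (E-sym e)))
          ; bc = ne } , there (start-∈ p)
    ... | yes eq with search p t≢b t≢c b≢c eq
                       (trans (nx-adj (E-sym e) (≢-sym t≢b) (≢-sym a≢b)) atB)
                       (trans (nx-adj (E-sym e) (≢-sym t≢c) (≢-sym a≢c)) atC)
    ... | M , i = record
          { mid = mid ; mid≢a = mid≢a′ ; mid≢b = mid≢b ; mid≢c = mid≢c
          ; ab = ab ∘ trans same ; ac = ac ∘ trans same ; bc = bc } , there i
          where
          open Median M
          mid≢a′ : mid ≢ a
          mid≢a′ eq′ = a∉ (subst (_∈ l) eq′ i)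
          same : nx mid t ≡ nx mid a
          same = nx-adj (E-sym e) mid≢a mid≢a′

  -- The three equations say that none of the vertices lies between the other two, so their median
  -- is a branch vertex different from all three.
  median : ∀ {a b c} → a ≢ b → a ≢ c → b ≢ c →
           nx a b ≡ nx a c → nx b a ≡ nx b c → nx c a ≡ nx c b → Median a b c
  median {a} {b} a≢b a≢c b≢c x y z = proj₁ (search (proj₂ (simplePath a b)) a≢b a≢c b≢c x y z)

-- Paths in a tree: directions, intersections and splits

Edge? : ∀ {A : Set} → DecidableEquality A → ∀ l (a b : A) → Dec (Edge l a b)
Edge? _≟_ []      a b = no λ ()
Edge? _≟_ (_ ∷ []) a b = no λ { (later ()) }
Edge? _≟_ (x ∷ y ∷ l) a b =
  map′ (λ { (inj₁ (refl , refl)) → fwd ; (inj₂ (inj₁ (refl , refl))) → bwd ; (inj₂ (inj₂ e)) → later e })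
       (λ { fwd → inj₁ (refl , refl) ; bwd → inj₂ (inj₁ (refl , refl)) ; (later e) → inj₂ (inj₂ e) })
       ((x ≟ a ×-dec y ≟ b) ⊎-dec ((x ≟ b ×-dec y ≟ a) ⊎-dec Edge? _≟_ (y ∷ l) a b))

EdgeIn? : ∀ {A : Set} → DecidableEquality A → ∀ l (a b : A) → Dec (EdgeIn l a b)
EdgeIn? _≟_ l a b = map′ Edge⇒EdgeIn EdgeIn⇒Edge (Edge? _≟_ l a b)

module PathTheory {m : ℕ} (T : Tree m) where

  open Tree T using (E)
  open TreeTheory T
  open Path using (verts)

  infix 4 _∋_
  _∋_ : Path T → Fin m → Set
  P ∋ a = a ∈ verts P

  path-simple : (P : Path T) → ∃₂ λ a b → SimplePath E a b (verts P)
  path-simple record { verts = a ∷ l ; chain = ch ; simple = un } = a , Linked⇒SimplePath ch un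
  path-simple record { verts = [] ; long = () }

  private
    Edge⇒E : ∀ {a b l c d} → SimplePath E a b l → Edge l c d → E c d
    Edge⇒E stop (later ())
    Edge⇒E (step e p _) ed with SimplePath-head p
    Edge⇒E (step e p _) fwd        | _ , refl = e
    Edge⇒E (step e p _) bwd        | _ , refl = E-sym e
    Edge⇒E (step e p _) (later ed) | _ , _    = Edge⇒E p ed

    Edge-nx : ∀ {s t l a b} → SimplePath E s t l → a ∈ l → b ∈ l → a ≢ b → Edge l a (nx a b)
    Edge-nx _ (here refl) (here refl) a≢b = contradiction refl a≢b
    Edge-nx {a = a} (step e p new) (here refl) (there j) _ with SimplePath-head p
    ... | _ , refl = subst (Edge _ a) (sym (nx-second e p new j)) fwd
    Edge-nx {a = a} (step {b = s} e p new) (there i) (here refl) a≢b with a ≟ s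
    ... | no a≢s = later (subst (Edge _ a) (nx-adj (E-sym e) a≢s a≢b) (Edge-nx p i (start-∈ p) a≢s))
    ... | yes refl with SimplePath-head p
    ...   | _ , refl = subst (Edge _ a) (sym (nx-nbr (E-sym e))) bwd
    Edge-nx (step e p new) (there i) (there j) a≢b = later (Edge-nx p i j a≢b)

    start-degree : ∀ {s t l a b} → SimplePath E s t l → Edge l s a → Edge l s b → a ≡ b
    start-degree stop (later ()) _
    start-degree {s} (step {b = u} {l = l} e p new) ea eb = trans (only ea) (sym (only eb))
      where
      only : ∀ {a} → Edge (s ∷ l) s a → a ≡ u
      only ed with SimplePath-head p
      only fwd        | _ , refl = refl
      only bwd        | _ , refl = contradiction (here refl) new
      only (later ed) | _ = contradiction (Edge-∈ ed) new

    -- Induction on the path: its start has one neighbour, its second vertex has the start and one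
    -- more, and no other vertex meets the first edge.
    Edge-degree : ∀ {s t l v a b c} → SimplePath E s t l → Edge l v a → Edge l v b → Edge l v c →
                  a ≢ b → a ≢ c → b ≢ c → ⊥
    Edge-degree stop (later ()) _ _ _ _ _
    Edge-degree {s} {v = v} q@(step {b = u} e p new) ea eb ec a≢b a≢c b≢c with v ≟ s
    ... | yes refl = a≢b (start-degree q ea eb)
    ... | no v≢s with v ≟ u
    ...   | yes refl = atSecond (split ea) (split eb) (split ec)
            where
            split : ∀ {a} → Edge _ v a → a ≡ s ⊎ Edge _ v a
            split ed with SimplePath-head p
            split fwd        | _ , refl = contradiction refl v≢s
            split bwd        | _ , refl = inj₁ refl
            split (later ed) | _ = inj₂ ed
            atSecond : _ → _ → _ → ⊥
            atSecond (inj₁ x) (inj₁ y) _        = a≢b (trans x (sym y))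
            atSecond (inj₁ x) (inj₂ _) (inj₁ z) = a≢c (trans x (sym z))
            atSecond (inj₂ _) (inj₁ y) (inj₁ z) = b≢c (trans y (sym z))
            atSecond (inj₂ x) (inj₂ y) _        = a≢b (start-degree p x y)
            atSecond (inj₂ x) (inj₁ _) (inj₂ z) = a≢c (start-degree p x z)
            atSecond (inj₁ _) (inj₂ y) (inj₂ z) = b≢c (start-degree p y z)
    ...   | no v≢u = Edge-degree p (drop ea) (drop eb) (drop ec) a≢b a≢c b≢c
            where
            drop : ∀ {a} → Edge _ v a → Edge _ v a
            drop ed with SimplePath-head p
            drop fwd        | _ , refl = contradiction refl v≢s
            drop bwd        | _ , refl = contradiction refl v≢u
            drop (later ed) | _ = ed

  edge-sym : ∀ P {a b} → edge P a b → edge {T = T} P b a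
  edge-sym P = EdgeIn-sym

  edge⇒∋ : ∀ P {a b} → edge P a b → P ∋ a
  edge⇒∋ P = Edge-∈ ∘ EdgeIn⇒Edge

  edge⇒∋ʳ : ∀ P {a b} → edge P a b → P ∋ b
  edge⇒∋ʳ P = edge⇒∋ P ∘ edge-sym P

  edge⇒E : ∀ P {a b} → edge P a b → E a b
  edge⇒E P e = Edge⇒E (proj₂ (proj₂ (path-simple P))) (EdgeIn⇒Edge e)

  -- Convexity: the tree path between two vertices of `P` runs inside `P`. Its first edge is all
  -- that arguments with directions use.
  edge-nx : ∀ P {a b} → P ∋ a → P ∋ b → a ≢ b → edge P a (nx a b)
  edge-nx P i j a≢b = Edge⇒EdgeIn (Edge-nx (proj₂ (proj₂ (path-simple P))) i j a≢b)

  edge-degree : ∀ P {v a b c} → edge P v a → edge P v b → edge P v c →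
                a ≢ b → a ≢ c → b ≢ c → ⊥
  edge-degree P ea eb ec =
    Edge-degree (proj₂ (proj₂ (path-simple P))) (EdgeIn⇒Edge ea) (EdgeIn⇒Edge eb) (EdgeIn⇒Edge ec)

  path-nx-const : ∀ P {t a b} → ¬ P ∋ t → P ∋ a → P ∋ b → nx t a ≡ nx t b
  path-nx-const P = nx-const (proj₂ (proj₂ (path-simple P)))

  edge? : ∀ P a b → Dec (edge {T = T} P a b)
  edge? P = EdgeIn? _≟_ (verts P)

  Intersect-sym : ∀ {P Q : Path T} → Intersect P Q → Intersect Q P
  Intersect-sym (a , b , p , q) = a , b , q , p

  ∼-sym : ∀ {P Q : Path T} → P ∼ Q → Q ∼ P
  ∼-sym {P} {Q} (i , ns) = Intersect-sym {P} {Q} i ,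
    λ x (a , b , c , ab , ac , bc , ea , eb , ec) → ns x (a , b , c , ab , ac , bc , swap ea , swap eb , swap ec)

  inSplit? : ∀ (P Q : Path T) x → Dec (InSplit P Q x)
  inSplit? P Q x = any? λ a → any? λ b → any? λ c →
    ¬? (a ≟ b) ×-dec ¬? (a ≟ c) ×-dec ¬? (b ≟ c) ×-dec in? a ×-dec in? b ×-dec in? c
    where
    in? : ∀ y → Dec (edge P x y ⊎ edge Q x y)
    in? y = edge? P x y ⊎-dec edge? Q x y

  -- A negated `∼` carries no witness; one is found because splitting is decidable at each of the
  -- finitely many vertices.
  intersecting⇒split : ∀ {P Q : Path T} → Intersect P Q → ¬ (P ∼ Q) → ∃ (InSplit P Q)
  intersecting⇒split {P} {Q} i ¬∼ =
    decidable-stable (any? (inSplit? P Q)) λ ne → ¬∼ (i , λ x s → ne (x , s))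

  -- If `a` is on `P`, the edge of `P` from `a` towards `p` ends at `b`. If it is not, `a` sees all
  -- of `P` in one direction, which puts `q` on the side of `b` too.
  crossing : ∀ P {a b p q} → Side a b p → Side b a q → P ∋ p → P ∋ q → edge P a b
  crossing P {a} {b} {p} {q} (p≢a , eq) sq p∈ q∈ with a ∈? verts P
  ... | yes a∈ = subst (edge P a) eq (edge-nx P a∈ p∈ (≢-sym p≢a))
  ... | no a∉  = ⊥-elim (side-excl
        ((λ { refl → a∉ q∈ }) , trans (path-nx-const P a∉ q∈ p∈) eq) sq)

  directions : ∀ Q {t r s p} → edge Q t r → edge Q t s → r ≢ s →
               Q ∋ p → p ≢ t → nx t p ≡ r ⊎ nx t p ≡ s
  directions Q {t} {r} {s} {p} er es r≢s p∈ p≢t with nx t p ≟ r | nx t p ≟ s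
  ... | yes eq | _      = inj₁ eq
  ... | no _   | yes eq = inj₂ eq
  ... | no ¬r  | no ¬s  =
    ⊥-elim (edge-degree Q er es (edge-nx Q (edge⇒∋ Q er) p∈ (≢-sym p≢t)) r≢s (≢-sym ¬r) (≢-sym ¬s))

  -- If `M` passes through `t`, a third direction would make `t` a split. If it misses `t`, it lies
  -- wholly in the direction of an edge that it shares with `Q`.
  directions-∼ : ∀ M Q {t r s p} → M ∼ Q → edge Q t r → edge Q t s → r ≢ s →
                 M ∋ p → p ≢ t → nx t p ≡ r ⊎ nx t p ≡ s
  directions-∼ M Q {t} {r} {s} {p} ((a , b , eM , eQ) , ns) er es r≢s p∈ p≢t with t ∈? verts M
  ... | no t∉ with directions Q er es r≢s (edge⇒∋ Q eQ) (λ { refl → t∉ (edge⇒∋ M eM) })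
  ...   | inj₁ eq = inj₁ (trans (path-nx-const M t∉ p∈ (edge⇒∋ M eM)) eq)
  ...   | inj₂ eq = inj₂ (trans (path-nx-const M t∉ p∈ (edge⇒∋ M eM)) eq)
  directions-∼ M Q {t} {r} {s} {p} (_ , ns) er es r≢s p∈ p≢t | yes t∈ with nx t p ≟ r | nx t p ≟ s
  ... | yes eq | _      = inj₁ eq
  ... | no _   | yes eq = inj₂ eq
  ... | no ¬r  | no ¬s  = ⊥-elim (ns t (r , s , nx t p , r≢s , ≢-sym ¬r , ≢-sym ¬s ,
                            inj₂ er , inj₂ es , inj₁ (edge-nx M t∈ p∈ (≢-sym p≢t))))

  -- Normal form of a split of two intersecting paths: of the three edges at `at`, one is common and
  -- each path has one of its own.
  record Split (P Q : Path T) : Set where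
    constructor mkSplit
    field
      at left right shared : Fin m
      P-left   : edge P at left
      P-shared : edge P at shared
      Q-right  : edge Q at right
      Q-shared : edge Q at shared
      left≢right   : left ≢ right
      left≢shared  : left ≢ shared
      right≢shared : right ≢ shared

  Split-sym : ∀ {P Q} → Split P Q → Split Q P
  Split-sym (mkSplit t l r s a b c d lr ls rs) = mkSplit t r l s c d a b (≢-sym lr) rs ls

  private
    -- The common edge has an end other than `t`. Both paths leave `t` towards it by the same edge,
    -- which for `P` must be the one to `a` or the one to `b`.
    split-shared : ∀ P Q {t a b c} → Intersect P Q → edge P t a → edge P t b → edge Q t c →
                   a ≢ b → a ≢ c → b ≢ c → Split P Q
    split-shared P Q {t} {a} {b} {c} (p , q , eP , eQ) ea eb ec a≢b a≢c b≢c = go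
      where
      use : ∀ {r} → P ∋ r → Q ∋ r → r ≢ t → Split P Q
      use r∈P r∈Q r≢t with directions P ea eb a≢b r∈P r≢t
      ... | inj₁ eq = mkSplit t b c a eb ea ec
            (subst (edge Q t) eq (edge-nx Q (edge⇒∋ Q ec) r∈Q (≢-sym r≢t))) b≢c (≢-sym a≢b) (≢-sym a≢c)
      ... | inj₂ eq = mkSplit t a c b ea eb ec
            (subst (edge Q t) eq (edge-nx Q (edge⇒∋ Q ec) r∈Q (≢-sym r≢t))) a≢c a≢b (≢-sym b≢c)
      go : Split P Q
      go with p ≟ t
      ... | no p≢t  = use (edge⇒∋ P eP) (edge⇒∋ Q eQ) p≢t
      ... | yes refl = use (edge⇒∋ʳ P eP) (edge⇒∋ʳ Q eQ) (≢-sym (E⇒≢ (edge⇒E P eP)))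

  split-form : ∀ P Q → Intersect P Q → ∃ (InSplit P Q) → Split P Q
  split-form P Q i (t , a , b , c , ab , ac , bc , ea , eb , ec) = go ea eb ec
    where
    go : edge P t a ⊎ edge Q t a → edge P t b ⊎ edge Q t b → edge P t c ⊎ edge Q t c → Split P Q
    go (inj₁ ea) (inj₁ eb) (inj₁ ec) = ⊥-elim (edge-degree P ea eb ec ab ac bc)
    go (inj₁ ea) (inj₁ eb) (inj₂ ec) = split-shared P Q i ea eb ec ab ac bc
    go (inj₁ ea) (inj₂ eb) (inj₁ ec) = split-shared P Q i ea ec eb ac ab (≢-sym bc)
    go (inj₂ ea) (inj₁ eb) (inj₁ ec) = split-shared P Q i eb ec ea bc (≢-sym ab) (≢-sym ac)
    go (inj₂ ea) (inj₂ eb) (inj₁ ec) = Split-sym (split-shared Q P (Intersect-sym {P} {Q} i) ea eb ec ab ac bc)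
    go (inj₂ ea) (inj₁ eb) (inj₂ ec) = Split-sym (split-shared Q P (Intersect-sym {P} {Q} i) ea ec eb ac ab (≢-sym bc))
    go (inj₁ ea) (inj₂ eb) (inj₂ ec) = Split-sym (split-shared Q P (Intersect-sym {P} {Q} i) eb ec ea bc (≢-sym ab) (≢-sym ac))
    go (inj₂ ea) (inj₂ eb) (inj₂ ec) = ⊥-elim (edge-degree Q ea eb ec ab ac bc)

  splitting : ∀ P Q → Intersect P Q → ¬ (P ∼ Q) → Split P Q
  splitting P Q i ¬∼ = split-form P Q i (intersecting⇒split {P} {Q} i ¬∼)

  -- At the median of a, b and c the paths Q ∋ a, b and M ∋ c would split.
  no-tripod : ∀ M Q {a b c} → M ∼ Q → Q ∋ a → Q ∋ b → M ∋ c → a ≢ b → a ≢ c → b ≢ c →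
              nx a b ≡ nx a c → nx b a ≡ nx b c → nx c a ≡ nx c b → ⊥
  no-tripod M Q {a} {b} {c} M∼Q a∈ b∈ c∈ a≢b a≢c b≢c x y z = absurd
    where
    open Median (median a≢b a≢c b≢c x y z) renaming (mid to t)
    t∈Q : Q ∋ t
    t∈Q with t ∈? verts Q
    ... | yes t∈ = t∈
    ... | no t∉  = contradiction (path-nx-const Q t∉ a∈ b∈) ab
    absurd : ⊥
    absurd with directions-∼ M Q M∼Q (edge-nx Q t∈Q a∈ mid≢a) (edge-nx Q t∈Q b∈ mid≢b) ab c∈ (≢-sym mid≢c)
    ... | inj₁ eq = ac (sym eq)
    ... | inj₂ eq = bc (sym eq)

-- The shape of a representation

mirror : Fin 5 → Fin 5
mirror 0F = 3F
mirror 1F = 2F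
mirror 2F = 1F
mirror 3F = 0F
mirror 4F = 4F

module Structure {m : ℕ} (T : Tree m) where

  open Tree T using (E)
  open TreeTheory T
  open PathTheory T

  -- A representation of the pair, of which only the K₄ on 0, 1, 2, 3 is known besides the cycle.
  record Pentagon (Q : Fin 5 → Path T) : Set where
    field
      ∼01 : Q 0F ∼ Q 1F
      ∼12 : Q 1F ∼ Q 2F
      ∼23 : Q 2F ∼ Q 3F
      ∼34 : Q 3F ∼ Q 4F
      ∼40 : Q 4F ∼ Q 0F
      meet02 : Intersect (Q 0F) (Q 2F)
      meet03 : Intersect (Q 0F) (Q 3F)
      meet13 : Intersect (Q 1F) (Q 3F)
      ≁02 : ¬ (Q 0F ∼ Q 2F)
      ≁03 : ¬ (Q 0F ∼ Q 3F)
      ≁13 : ¬ (Q 1F ∼ Q 3F)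
      ≁14 : ¬ (Q 1F ∼ Q 4F)
      ≁24 : ¬ (Q 2F ∼ Q 4F)

  -- The branch vertices u and v of the standard tree, with one tree edge for each of its six edges:
  -- au = xU, bu = yU, um = g₁g₂, mv = h₁h₂, vc = Vc, vd = Vd.
  record Skeleton (Q : Fin 5 → Path T) : Set where
    field
      U V x y z c d w g₁ g₂ h₁ h₂ : Fin m
    Inner : Fin m → Set
    Inner p = (p ≢ U → nx U p ≡ z) × (p ≢ V → nx V p ≡ w)
    field
      x≢y : x ≢ y
      x≢z : x ≢ z
      y≢z : y ≢ z
      c≢d : c ≢ d
      c≢w : c ≢ w
      d≢w : d ≢ w
      UV  : nx U V ≡ z
      VU  : nx V U ≡ w
      Uc  : c ≢ U × nx U c ≡ z
      Ud  : d ≢ U × nx U d ≡ z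
      g₁-inner : Inner g₁
      g₂-inner : Inner g₂
      h₁-inner : Inner h₁
      h₂-inner : Inner h₂
      g-U  : Side g₂ g₁ U
      h-U  : Side h₂ h₁ U
      h-V  : Side h₁ h₂ V
      h-g₁ : Side h₂ h₁ g₁
      h-g₂ : Side h₂ h₁ g₂
      g-h₁ : Side g₁ g₂ h₁
      0x : edge (Q 0F) U x
      0g : edge (Q 0F) g₁ g₂
      0h : edge (Q 0F) h₁ h₂
      1g : edge (Q 1F) g₁ g₂
      1h : edge (Q 1F) h₁ h₂
      1c : edge (Q 1F) V c
      2y : edge (Q 2F) U y
      2g : edge (Q 2F) g₁ g₂
      3y : edge (Q 3F) U y
      3g : edge (Q 3F) g₁ g₂
      3h : edge (Q 3F) h₁ h₂
      3d : edge (Q 3F) V d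
      4h : edge (Q 4F) h₁ h₂
      4d : edge (Q 4F) V d
      apart24 : ¬ Intersect (Q 2F) (Q 4F)

  private
    -- Applied with `z` the edge shared at a split and `a`, `b` the edges that only one of the two
    -- paths uses.
    agree : ∀ {p a b z : Fin m} → p ≡ a ⊎ p ≡ z → p ≡ b ⊎ p ≡ z → a ≢ b → p ≡ z
    agree _         (inj₂ p≡z) _   = p≡z
    agree (inj₂ p≡z) _         _   = p≡z
    agree (inj₁ p≡a) (inj₁ p≡b) a≢b = contradiction (trans (sym p≡a) p≡b) a≢b

  module Frame (Q : Fin 5 → Path T) (pent : Pentagon Q)
               (S02 : Split (Q 0F) (Q 2F)) (S13 : Split (Q 1F) (Q 3F)) where
    open Pentagon pent
    open Split S02 using () renaming
      ( at to U; left to x; right to y; shared to z; P-left to 0x; P-shared to 0z; Q-right to 2y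
      ; Q-shared to 2z; left≢right to x≢y; left≢shared to x≢z; right≢shared to y≢z)
    open Split S13 using () renaming
      ( at to V; left to c; right to d; shared to w; P-left to 1c; P-shared to 1w; Q-right to 3d
      ; Q-shared to 3w; left≢right to c≢d; left≢shared to c≢w; right≢shared to d≢w)

    Q0 Q1 Q2 Q3 Q4 : Path T
    Q0 = Q 0F
    Q1 = Q 1F
    Q2 = Q 2F
    Q3 = Q 3F
    Q4 = Q 4F

    ∼10 : Q1 ∼ Q0
    ∼10 = ∼-sym {Q0} {Q1} ∼01
    ∼21 : Q2 ∼ Q1
    ∼21 = ∼-sym {Q1} {Q2} ∼12
    ∼32 : Q3 ∼ Q2
    ∼32 = ∼-sym {Q2} {Q3} ∼23
    ∼43 : Q4 ∼ Q3
    ∼43 = ∼-sym {Q3} {Q4} ∼34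

    U∈0 : Q0 ∋ U
    U∈0 = edge⇒∋ Q0 0x
    U∈2 : Q2 ∋ U
    U∈2 = edge⇒∋ Q2 2y
    V∈1 : Q1 ∋ V
    V∈1 = edge⇒∋ Q1 1c
    V∈3 : Q3 ∋ V
    V∈3 = edge⇒∋ Q3 3d

    1-from-U : ∀ {p} → Q1 ∋ p → p ≢ U → nx U p ≡ z
    1-from-U p∈ p≢ = agree (directions-∼ Q1 Q0 ∼10 0x 0z x≢z p∈ p≢)
                           (directions-∼ Q1 Q2 ∼12 2y 2z y≢z p∈ p≢) x≢y

    2-from-V : ∀ {p} → Q2 ∋ p → p ≢ V → nx V p ≡ w
    2-from-V p∈ p≢ = agree (directions-∼ Q2 Q1 ∼21 1c 1w c≢w p∈ p≢)
                           (directions-∼ Q2 Q3 ∼23 3d 3w d≢w p∈ p≢) c≢d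

    -- If they coincided, both edges of `Q1` at this vertex would lead to `z`.
    U≢V : U ≢ V
    U≢V U≡V = c≢w (trans (eq 1c) (sym (eq 1w)))
      where
      eq : ∀ {p} → edge Q1 V p → p ≡ z
      eq {p} e = trans (sym (nx-nbr e′)) (1-from-U (edge⇒∋ʳ Q1 e) (≢-sym (E⇒≢ e′)))
        where e′ = subst (λ v → E v p) (sym U≡V) (edge⇒E Q1 e)

    UV : nx U V ≡ z
    UV = 1-from-U V∈1 (≢-sym U≢V)

    VU : nx V U ≡ w
    VU = 2-from-V U∈2 U≢V

    -- A split `t` elsewhere sees `U` and `V` through its shared edge, `U` sees `V` and `t` through
    -- `z`, and `V` sees `U` and `t` through `w`: a tripod with `U`, `t` on `Q0` and `V` on `Q1`.
    locate : (S03 : Split Q0 Q3) → Split.at S03 ≡ U ⊎ Split.at S03 ≡ V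
    locate (mkSplit t r s q 0r 0q 3s 3q r≢s r≢q s≢q) with t ≟ U | t ≟ V
    ... | yes t≡U | _ = inj₁ t≡U
    ... | no _ | yes t≡V = inj₂ t≡V
    ... | no t≢U | no t≢V = ⊥-elim (no-tripod Q1 Q0 ∼10 U∈0 t∈0 V∈1 (≢-sym t≢U) U≢V t≢V
            (trans Ut (sym UV)) (trans tU (sym tV)) (trans VU (sym Vt)))
      where
      t∈0 : Q0 ∋ t
      t∈0 = edge⇒∋ Q0 0r
      t∈3 : Q3 ∋ t
      t∈3 = edge⇒∋ Q3 3s
      tU : nx t U ≡ q
      tU = agree (directions Q0 0r 0q r≢q U∈0 (≢-sym t≢U))
                 (directions-∼ Q2 Q3 ∼23 3s 3q s≢q U∈2 (≢-sym t≢U)) r≢s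
      tV : nx t V ≡ q
      tV = agree (directions-∼ Q1 Q0 ∼10 0r 0q r≢q V∈1 (≢-sym t≢V))
                 (directions Q3 3s 3q s≢q V∈3 (≢-sym t≢V)) r≢s
      Ut : nx U t ≡ z
      Ut = agree (directions Q0 0x 0z x≢z t∈0 t≢U) (directions-∼ Q3 Q2 ∼32 2y 2z y≢z t∈3 t≢U) x≢y
      Vt : nx V t ≡ w
      Vt = agree (directions-∼ Q0 Q1 ∼01 1c 1w c≢w t∈0 t≢V) (directions Q3 3d 3w d≢w t∈3 t≢V) c≢d

    -- Besides the path from `U` to `V` this includes whatever hangs off its interior vertices.
    Inner : Fin m → Set
    Inner p = (p ≢ U → nx U p ≡ z) × (p ≢ V → nx V p ≡ w)

    record Separator (p q : Fin m) : Set where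
      field
        near far : Fin m
        same     : (near ≡ p × far ≡ q) ⊎ (near ≡ q × far ≡ p)
        near-inner : Inner near
        far-inner  : Inner far
        U-side : Side far near U
        V-side : Side near far V

    carry : ∀ {p q} (s : Separator p q) P → edge P p q → edge P (Separator.near s) (Separator.far s)
    carry s P e with Separator.same s
    ... | inj₁ (refl , refl) = e
    ... | inj₂ (refl , refl) = edge-sym P e

    -- If `U` and `V` were on the same side of the edge, its end away from them would form a tripod
    -- with `U` on `P` and `V` on `Q1`.
    separator : ∀ P {p q} → edge P p q → P ∋ U → Q1 ∼ P → Inner p → Inner q → Separator p q
    separator P {p} {q} e U∈ 1∼P ip iq with side-total E′ U | side-total E′ V
      where E′ = edge⇒E P e
    ... | inj₂ sU | inj₁ sV = record { near = p ; far = q ; same = inj₁ (refl , refl)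
            ; near-inner = ip ; far-inner = iq ; U-side = sU ; V-side = sV }
    ... | inj₁ sU | inj₂ sV = record { near = q ; far = p ; same = inj₂ (refl , refl)
            ; near-inner = iq ; far-inner = ip ; U-side = sU ; V-side = sV }
    ... | inj₁ (U≢p , pU) | inj₁ (V≢p , pV) =
          ⊥-elim (no-tripod Q1 P 1∼P U∈ (edge⇒∋ P e) V∈1 U≢p U≢V (≢-sym V≢p)
            (trans (proj₁ ip (≢-sym U≢p)) (sym UV)) (trans pU (sym pV))
            (trans VU (sym (proj₂ ip (≢-sym V≢p)))))
    ... | inj₂ (U≢q , qU) | inj₂ (V≢q , qV) =
          ⊥-elim (no-tripod Q1 P 1∼P U∈ (edge⇒∋ʳ P e) V∈1 U≢q U≢V (≢-sym V≢q)
            (trans (proj₁ iq (≢-sym U≢q)) (sym UV)) (trans qU (sym qV))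
            (trans VU (sym (proj₂ iq (≢-sym V≢q)))))

    skeleton : (S03 : Split Q0 Q3) → Split.at S03 ≡ U → Skeleton Q
    skeleton (mkSplit _ r s q 0r 0q 3s 3q r≢s r≢q s≢q) refl = result
      where
      -- The splits of `Q0` with `Q2` and with `Q3` share the same edge at `U`: `Q0` offers only `x`
      -- and `z`, and `Q3`, in relation `∼` to `Q2`, only `y` and `z`.
      q≡z : q ≡ z
      q≡z = agree (dir0 0q) (dir3 3q) x≢y
        where
        dir0 : ∀ {p} → edge Q0 U p → p ≡ x ⊎ p ≡ z
        dir0 {p} e = subst (λ n → n ≡ x ⊎ n ≡ z) (nx-nbr (edge⇒E Q0 e))
          (directions Q0 0x 0z x≢z (edge⇒∋ʳ Q0 e) (≢-sym (E⇒≢ (edge⇒E Q0 e))))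
        dir3 : ∀ {p} → edge Q3 U p → p ≡ y ⊎ p ≡ z
        dir3 {p} e = subst (λ n → n ≡ y ⊎ n ≡ z) (nx-nbr (edge⇒E Q3 e))
          (directions-∼ Q3 Q2 ∼32 2y 2z y≢z (edge⇒∋ʳ Q3 e) (≢-sym (E⇒≢ (edge⇒E Q3 e))))

      s≡y : s ≡ y
      s≡y with subst (λ n → n ≡ y ⊎ n ≡ z) (nx-nbr (edge⇒E Q3 3s))
                 (directions-∼ Q3 Q2 ∼32 2y 2z y≢z (edge⇒∋ʳ Q3 3s) (≢-sym (E⇒≢ (edge⇒E Q3 3s))))
      ... | inj₁ s≡y = s≡y
      ... | inj₂ s≡z = contradiction (trans s≡z (sym q≡z)) s≢q

      3y : edge Q3 U y
      3y = subst (edge Q3 U) s≡y 3s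

      3z : edge Q3 U z
      3z = subst (edge Q3 U) q≡z 3q

      U∈3 : Q3 ∋ U
      U∈3 = edge⇒∋ Q3 3y

      4-from-U : ∀ {p} → Q4 ∋ p → p ≢ U → nx U p ≡ z
      4-from-U p∈ p≢ = agree (directions-∼ Q4 Q0 ∼40 0x 0z x≢z p∈ p≢)
                             (directions-∼ Q4 Q3 ∼43 3y 3z y≢z p∈ p≢) x≢y

      4-at-U : ∀ {a b} → edge Q4 U a → edge Q4 U b → a ≡ b
      4-at-U ea eb = trans (eq ea) (sym (eq eb))
        where
        eq : ∀ {p} → edge Q4 U p → p ≡ z
        eq e = trans (sym (nx-nbr (edge⇒E Q4 e))) (4-from-U (edge⇒∋ʳ Q4 e) (≢-sym (E⇒≢ (edge⇒E Q4 e))))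

      2-at-V : ∀ {a b} → edge Q2 V a → edge Q2 V b → a ≡ b
      2-at-V ea eb = trans (eq ea) (sym (eq eb))
        where
        eq : ∀ {p} → edge Q2 V p → p ≡ w
        eq e = trans (sym (nx-nbr (edge⇒E Q2 e))) (2-from-V (edge⇒∋ʳ Q2 e) (≢-sym (E⇒≢ (edge⇒E Q2 e))))

      -- `Q3` is in relation `∼` to both paths, so a split vertex sees it only through their shared
      -- edge. As `Q3` contains `U` and `V`, these two and the split vertex on `Q2` form a tripod.
      no-split24 : Split Q2 Q4 → ⊥
      no-split24 (mkSplit t a b k 2a 2k 4b 4k a≢b a≢k b≢k) =
        no-tripod Q2 Q3 ∼23 U∈3 V∈3 t∈2 U≢V (≢-sym t≢U) (≢-sym t≢V)
          (trans UV (sym (4-from-U t∈4 t≢U))) (trans VU (sym (2-from-V t∈2 t≢V)))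
          (trans (from-t U∈3 (≢-sym t≢U)) (sym (from-t V∈3 (≢-sym t≢V))))
        where
        t∈2 : Q2 ∋ t
        t∈2 = edge⇒∋ Q2 2a
        t∈4 : Q4 ∋ t
        t∈4 = edge⇒∋ Q4 4b
        t≢U : t ≢ U
        t≢U refl = b≢k (4-at-U 4b 4k)
        t≢V : t ≢ V
        t≢V refl = a≢k (2-at-V 2a 2k)
        from-t : ∀ {p} → Q3 ∋ p → p ≢ t → nx t p ≡ k
        from-t p∈ p≢ = agree (directions-∼ Q3 Q2 ∼32 2a 2k a≢k p∈ p≢)
                             (directions-∼ Q3 Q4 ∼34 4b 4k b≢k p∈ p≢) a≢b

      apart24 : ¬ Intersect Q2 Q4
      apart24 i = no-split24 (splitting Q2 Q4 i ≁24)

      -- A common edge of `Q1` and `Q2` is inner: `U` sees `Q1` only through `z`, and `V` sees `Q2`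
      -- only through `w`.
      sg : Separator (proj₁ (proj₁ ∼12)) (proj₁ (proj₂ (proj₁ ∼12)))
      sg with proj₁ ∼12
      ... | a , b , 1e , 2e = separator Q2 2e U∈2 ∼12
              (1-from-U (edge⇒∋ Q1 1e) , 2-from-V (edge⇒∋ Q2 2e))
              (1-from-U (edge⇒∋ʳ Q1 1e) , 2-from-V (edge⇒∋ʳ Q2 2e))

      sh : Separator (proj₁ (proj₁ ∼40)) (proj₁ (proj₂ (proj₁ ∼40)))
      sh with proj₁ ∼40
      ... | a , b , 4e , 0e = separator Q0 0e U∈0 ∼10
              (4-from-U (edge⇒∋ Q4 4e) , from-V (edge⇒∋ Q4 4e) (edge⇒∋ Q0 0e))
              (4-from-U (edge⇒∋ʳ Q4 4e) , from-V (edge⇒∋ʳ Q4 4e) (edge⇒∋ʳ Q0 0e))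
        where
        from-V : ∀ {p} → Q4 ∋ p → Q0 ∋ p → p ≢ V → nx V p ≡ w
        from-V p∈4 p∈0 p≢ = agree (directions-∼ Q0 Q1 ∼01 1c 1w c≢w p∈0 p≢)
                                  (directions-∼ Q4 Q3 ∼43 3d 3w d≢w p∈4 p≢) c≢d

      open Separator sg using () renaming
        (near to g₁; far to g₂; near-inner to g₁-inner; far-inner to g₂-inner; U-side to g-U; V-side to g-V)
      open Separator sh using () renaming
        (near to h₁; far to h₂; near-inner to h₁-inner; far-inner to h₂-inner; U-side to h-U; V-side to h-V)

      1g : edge Q1 g₁ g₂
      1g = carry sg Q1 (proj₁ (proj₂ (proj₂ (proj₁ ∼12))))
      2g : edge Q2 g₁ g₂
      2g = carry sg Q2 (proj₂ (proj₂ (proj₂ (proj₁ ∼12))))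
      4h : edge Q4 h₁ h₂
      4h = carry sh Q4 (proj₁ (proj₂ (proj₂ (proj₁ ∼40))))
      0h : edge Q0 h₁ h₂
      0h = carry sh Q0 (proj₂ (proj₂ (proj₂ (proj₁ ∼40))))

      -- `Q3` contains `U` and `V`, hence every edge that separates them.
      3g : edge Q3 g₁ g₂
      3g = crossing Q3 g-V g-U V∈3 U∈3
      3h : edge Q3 h₁ h₂
      3h = crossing Q3 h-V h-U V∈3 U∈3

      -- Otherwise the edge h₁h₂ of Q4 would also lie on Q2.
      U-side-of-h : ∀ {p} → Q2 ∋ p → Side h₂ h₁ p
      U-side-of-h {p} p∈ =
        [ (λ s → contradiction (h₁ , h₂ , crossing Q2 s h-U p∈ U∈2 , 4h) apart24) , (λ s → s) ]′
        (side-total (edge⇒E Q4 4h) p)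

      h-g₁ : Side h₂ h₁ g₁
      h-g₁ = U-side-of-h (edge⇒∋ Q2 2g)
      h-g₂ : Side h₂ h₁ g₂
      h-g₂ = U-side-of-h (edge⇒∋ʳ Q2 2g)

      1h : edge Q1 h₁ h₂
      1h = crossing Q1 h-V h-g₂ V∈1 (edge⇒∋ʳ Q1 1g)

      V≢g₂ : V ≢ g₂
      V≢g₂ V≡g₂ = side-excl h-V (subst (Side h₂ h₁) (sym V≡g₂) h-g₂)

      -- If `h₁` were on the side of `U`, then `g₂` would lie between `h₁` and `V`. Thus `h₁` would
      -- see `g₂` through `h₂`, against `h-g₂`.
      g-h₁ : Side g₁ g₂ h₁
      g-h₁ = [ (λ side → side) , (λ side → ⊥-elim (wrong side)) ]′ (side-total (edge⇒E Q1 1g) h₁)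
        where
        wrong : Side g₂ g₁ h₁ → ⊥
        wrong (h₁≢g₂ , toward-g₁) = side-excl
          (≢-sym h₁≢g₂ , trans (sym (nx-between (≢-sym h₁≢g₂) (≢-sym V≢g₂) (≢-sym (proj₁ h-V))
             (λ eq → side-excl g-V (V≢g₂ , trans (sym eq) toward-g₁)))) (proj₂ h-V))
          h-g₂

      0g : edge Q0 g₁ g₂
      0g = crossing Q0 g-h₁ g-U (edge⇒∋ Q0 0h) U∈0

      -- A split `t` elsewhere sees both `U` and `V` through its shared edge, since both are on
      -- `Q3`, in relation `∼` to `Q4`. This gives a tripod with `V`, `t` on `Q1` and `U` on `Q0`.
      -- It is not `U`, where `Q4` has at most one edge.
      at-V : (S : Split Q1 Q4) → Split.at S ≡ V
      at-V (mkSplit t a b k 1a 1k 4b 4k a≢b a≢k b≢k) with t ≟ V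
      ... | yes t≡V = t≡V
      ... | no t≢V = ⊥-elim (no-tripod Q0 Q1 ∼01 V∈1 t∈1 U∈0 (≢-sym t≢V) (≢-sym U≢V) t≢U
              (trans Vt (sym VU)) (trans tV (sym tU)) (trans UV (sym (1-from-U t∈1 t≢U))))
        where
        t∈1 : Q1 ∋ t
        t∈1 = edge⇒∋ Q1 1a
        t∈4 : Q4 ∋ t
        t∈4 = edge⇒∋ Q4 4b
        t≢U : t ≢ U
        t≢U refl = b≢k (4-at-U 4b 4k)
        Vt : nx V t ≡ w
        Vt = agree (directions Q1 1c 1w c≢w t∈1 t≢V) (directions-∼ Q4 Q3 ∼43 3d 3w d≢w t∈4 t≢V) c≢d
        tV : nx t V ≡ k
        tV = agree (directions Q1 1a 1k a≢k V∈1 (≢-sym t≢V))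
                   (directions-∼ Q3 Q4 ∼34 4b 4k b≢k V∈3 (≢-sym t≢V)) a≢b
        tU : nx t U ≡ k
        tU = agree (directions-∼ Q0 Q1 ∼01 1a 1k a≢k U∈0 (≢-sym t≢U))
                   (directions-∼ Q3 Q4 ∼34 4b 4k b≢k U∈3 (≢-sym t≢U)) a≢b

      -- Because of `Q3`, the path `Q4` can leave `V` only to `d` or `w`, and the split with `Q1`
      -- gives it two edges there.
      4d : edge Q4 V d
      4d = pick S14 (at-V S14)
        where
        S14 : Split Q1 Q4
        S14 = splitting Q1 Q4 (h₁ , h₂ , 1h , 4h) ≁14
        dir4 : ∀ {p} → edge Q4 V p → p ≡ d ⊎ p ≡ w
        dir4 {p} e = subst (λ n → n ≡ d ⊎ n ≡ w) (nx-nbr (edge⇒E Q4 e))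
          (directions-∼ Q4 Q3 ∼43 3d 3w d≢w (edge⇒∋ʳ Q4 e) (≢-sym (E⇒≢ (edge⇒E Q4 e))))
        pick : (S : Split Q1 Q4) → Split.at S ≡ V → edge Q4 V d
        pick (mkSplit _ a b k 1a 1k 4b 4k a≢b a≢k b≢k) refl with dir4 4b | dir4 4k
        ... | inj₁ refl | _         = 4b
        ... | inj₂ _    | inj₁ refl = 4k
        ... | inj₂ b≡w  | inj₂ k≡w  = contradiction (trans b≡w (sym k≡w)) b≢k

      ≢U : ∀ {P p} → edge P V p → p ≢ w → p ≢ U
      ≢U {P} e p≢w refl = p≢w (trans (sym (nx-nbr (edge⇒E P e))) VU)

      result : Skeleton Q
      result = record
        { U = U ; V = V ; x = x ; y = y ; z = z ; c = c ; d = d ; w = w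
        ; g₁ = g₁ ; g₂ = g₂ ; h₁ = h₁ ; h₂ = h₂
        ; x≢y = x≢y ; x≢z = x≢z ; y≢z = y≢z ; c≢d = c≢d ; c≢w = c≢w ; d≢w = d≢w
        ; UV = UV ; VU = VU
        ; Uc = ≢U {Q1} 1c c≢w , 1-from-U (edge⇒∋ʳ Q1 1c) (≢U {Q1} 1c c≢w)
        ; Ud = ≢U {Q4} 4d d≢w , 4-from-U (edge⇒∋ʳ Q4 4d) (≢U {Q4} 4d d≢w)
        ; g₁-inner = g₁-inner ; g₂-inner = g₂-inner ; h₁-inner = h₁-inner ; h₂-inner = h₂-inner
        ; g-U = g-U ; h-U = h-U ; h-V = h-V ; h-g₁ = h-g₁ ; h-g₂ = h-g₂ ; g-h₁ = g-h₁
        ; 0x = 0x ; 0g = 0g ; 0h = 0h ; 1g = 1g ; 1h = 1h ; 1c = 1c ; 2y = 2y ; 2g = 2g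
        ; 3y = 3y ; 3g = 3g ; 3h = 3h ; 3d = 3d ; 4h = 4h ; 4d = 4d ; apart24 = apart24 }

  -- The reflection fixes 4, reverses the path 0, 1, 2, 3, and exchanges the chord 02 with 13 and 14
  -- with 24. Thus it exchanges the roles of `U` and `V`.
  mirror-pentagon : ∀ {Q} → Pentagon Q → Pentagon (Q ∘ mirror)
  mirror-pentagon {Q} pent = record
    { ∼01 = ∼-sym {Q 2F} {Q 3F} ∼23 ; ∼12 = ∼-sym {Q 1F} {Q 2F} ∼12 ; ∼23 = ∼-sym {Q 0F} {Q 1F} ∼01
    ; ∼34 = ∼-sym {Q 4F} {Q 0F} ∼40 ; ∼40 = ∼-sym {Q 3F} {Q 4F} ∼34
    ; meet02 = Intersect-sym {Q 1F} {Q 3F} meet13 ; meet03 = Intersect-sym {Q 0F} {Q 3F} meet03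
    ; meet13 = Intersect-sym {Q 0F} {Q 2F} meet02
    ; ≁02 = ≁13 ∘ ∼-sym {Q 3F} {Q 1F} ; ≁03 = ≁03 ∘ ∼-sym {Q 3F} {Q 0F}
    ; ≁13 = ≁02 ∘ ∼-sym {Q 2F} {Q 0F} ; ≁14 = ≁24 ; ≁24 = ≁14 }
    where open Pentagon pent

  pentagon⇒skeleton : ∀ {Q} → Pentagon Q → Skeleton Q ⊎ Skeleton (Q ∘ mirror)
  pentagon⇒skeleton {Q} pent = case (Frame.locate Q pent S02 S13 S03)
    where
    open Pentagon pent
    S02 = splitting (Q 0F) (Q 2F) meet02 ≁02
    S13 = splitting (Q 1F) (Q 3F) meet13 ≁13
    S03 = splitting (Q 0F) (Q 3F) meet03 ≁03
    case : Split.at S03 ≡ Split.at S02 ⊎ Split.at S03 ≡ Split.at S13 → Skeleton Q ⊎ Skeleton (Q ∘ mirror)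
    case (inj₁ atU) = inj₁ (Frame.skeleton Q pent S02 S13 S03 atU)
    case (inj₂ atV) = inj₂ (Frame.skeleton (Q ∘ mirror) (mirror-pentagon pent)
                              (Split-sym S13) (Split-sym S02) (Split-sym S03) atV)

-- Folding a representation onto the standard tree

stdList : Fin 5 → List (Fin 7)
stdList 0F = 0F ∷ 2F ∷ 3F ∷ 4F ∷ []
stdList 1F = 2F ∷ 3F ∷ 4F ∷ 5F ∷ []
stdList 2F = 1F ∷ 2F ∷ 3F ∷ []
stdList 3F = 1F ∷ 2F ∷ 3F ∷ 4F ∷ 6F ∷ []
stdList 4F = 3F ∷ 4F ∷ 6F ∷ []

-- A contraction of T onto the standard tree (its fibres are connected) under which
-- the paths cover the standard paths.
record Fold {m : ℕ} (T : Tree m) (Q : Fin 5 → Path T) : Set where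
  open Tree T using (E)
  field
    f      : Fin m → Fin 7
    hom    : ∀ {p q} → E p q → f p ≡ f q ⊎ stdTree (f p) (f q) ≡ true
    fibres : ∀ p q → f p ≡ f q → Star (λ a b → E a b × f a ≡ f b) p q
    covers : ∀ k {i j} → Edge (stdList k) i j → ∃₂ λ p q → f p ≡ i × f q ≡ j × edge (Q k) p q

module _ {m : ℕ} {T : Tree m} where

  open Tree T using (E)
  open TreeTheory T
  open PathTheory T
  open Structure T

  module SkeletonFold {Q : Fin 5 → Path T} (sk : Skeleton Q) where
    open Skeleton sk

    -- The first match wins, which makes it unnecessary to know how the six sides are nested.
    label : (x y c d h g : Bool) → Fin 7
    label true  _     _     _     _     _     = 0F
    label false true  _     _     _     _     = 1F
    label false false true  _     _     _     = 5F
    label false false false true  _     _     = 6F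
    label false false false false true  _     = 4F
    label false false false false false true  = 3F
    label false false false false false false = 2F

    f : Fin m → Fin 7
    f t = label (does (side? U x t)) (does (side? U y t)) (does (side? V c t)) (does (side? V d t))
                (does (side? h₁ h₂ t)) (does (side? g₁ g₂ t))

    -- Keeps the failed tests along with the successful one, so that a value of `f` can be analysed
    -- by cases.
    data Region (t : Fin m) : Fin 7 → Set where
      inA : Side U x t → Region t 0F
      inB : ¬ Side U x t → Side U y t → Region t 1F
      inC : ¬ Side U x t → ¬ Side U y t → Side V c t → Region t 5F
      inD : ¬ Side U x t → ¬ Side U y t → ¬ Side V c t → Side V d t → Region t 6F
      inV : ¬ Side U x t → ¬ Side U y t → ¬ Side V c t → ¬ Side V d t → Side h₁ h₂ t → Region t 4F
      inM : ¬ Side U x t → ¬ Side U y t → ¬ Side V c t → ¬ Side V d t → ¬ Side h₁ h₂ t →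
            Side g₁ g₂ t → Region t 3F
      inU : ¬ Side U x t → ¬ Side U y t → ¬ Side V c t → ¬ Side V d t → ¬ Side h₁ h₂ t →
            ¬ Side g₁ g₂ t → Region t 2F

    region : ∀ t → Region t (f t)
    region t with side? U x t | side? U y t | side? V c t | side? V d t | side? h₁ h₂ t | side? g₁ g₂ t
    ... | yes sx | _ | _ | _ | _ | _ = inA sx
    ... | no ¬x | yes sy | _ | _ | _ | _ = inB ¬x sy
    ... | no ¬x | no ¬y | yes sc | _ | _ | _ = inC ¬x ¬y sc
    ... | no ¬x | no ¬y | no ¬c | yes sd | _ | _ = inD ¬x ¬y ¬c sd
    ... | no ¬x | no ¬y | no ¬c | no ¬d | yes sh | _ = inV ¬x ¬y ¬c ¬d sh
    ... | no ¬x | no ¬y | no ¬c | no ¬d | no ¬h | yes sg = inM ¬x ¬y ¬c ¬d ¬h sg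
    ... | no ¬x | no ¬y | no ¬c | no ¬d | no ¬h | no ¬g = inU ¬x ¬y ¬c ¬d ¬h ¬g

    region⇒f : ∀ {t i} → Region t i → f t ≡ i
    region⇒f {t} (inA sx) rewrite dec-true (side? U x t) sx = refl
    region⇒f {t} (inB ¬x sy)
      rewrite dec-false (side? U x t) ¬x | dec-true (side? U y t) sy = refl
    region⇒f {t} (inC ¬x ¬y sc)
      rewrite dec-false (side? U x t) ¬x | dec-false (side? U y t) ¬y | dec-true (side? V c t) sc = refl
    region⇒f {t} (inD ¬x ¬y ¬c sd)
      rewrite dec-false (side? U x t) ¬x | dec-false (side? U y t) ¬y | dec-false (side? V c t) ¬c
            | dec-true (side? V d t) sd = refl
    region⇒f {t} (inV ¬x ¬y ¬c ¬d sh)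
      rewrite dec-false (side? U x t) ¬x | dec-false (side? U y t) ¬y | dec-false (side? V c t) ¬c
            | dec-false (side? V d t) ¬d | dec-true (side? h₁ h₂ t) sh = refl
    region⇒f {t} (inM ¬x ¬y ¬c ¬d ¬h sg)
      rewrite dec-false (side? U x t) ¬x | dec-false (side? U y t) ¬y | dec-false (side? V c t) ¬c
            | dec-false (side? V d t) ¬d | dec-false (side? h₁ h₂ t) ¬h | dec-true (side? g₁ g₂ t) sg = refl
    region⇒f {t} (inU ¬x ¬y ¬c ¬d ¬h ¬g)
      rewrite dec-false (side? U x t) ¬x | dec-false (side? U y t) ¬y | dec-false (side? V c t) ¬c
            | dec-false (side? V d t) ¬d | dec-false (side? h₁ h₂ t) ¬h | dec-false (side? g₁ g₂ t) ¬g = refl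

    -- The six cut edges, oriented away from `U`, from region `i` to region `j`. The test `Side a b`
    -- fails throughout region `i` and holds throughout region `j`.
    data CutEdge : Fin m → Fin m → Fin 7 → Fin 7 → Set where
      cutA : CutEdge U x 2F 0F
      cutB : CutEdge U y 2F 1F
      cutC : CutEdge V c 4F 5F
      cutD : CutEdge V d 4F 6F
      cutH : CutEdge h₁ h₂ 3F 4F
      cutG : CutEdge g₁ g₂ 2F 3F

    Side-≢ : ∀ {a b b′ t} → Side a b t → b ≢ b′ → ¬ Side a b′ t
    Side-≢ (_ , eq) ne (_ , eq′) = ne (trans (sym eq) eq′)

    inner-U : ∀ {t} b → Inner t → b ≢ z → ¬ Side U b t
    inner-U b (fromU , _) b≢z (t≢U , eq) = b≢z (trans (sym eq) (fromU t≢U))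

    inner-V : ∀ {t} b → Inner t → b ≢ w → ¬ Side V b t
    inner-V b (_ , fromV) b≢w (t≢V , eq) = b≢w (trans (sym eq) (fromV t≢V))

    U-inner : Inner U
    U-inner = (λ ne → contradiction refl ne) , λ _ → VU

    V-inner : Inner V
    V-inner = (λ _ → UV) , λ ne → contradiction refl ne

    f-inner : ∀ {t i} → Inner t → (¬ Side U x t → ¬ Side U y t → ¬ Side V c t → ¬ Side V d t → Region t i) →
              f t ≡ i
    f-inner i r = region⇒f (r (inner-U x i x≢z) (inner-U y i y≢z) (inner-V c i c≢w) (inner-V d i d≢w))

    cut-f : ∀ {a b i j} → CutEdge a b i j → f a ≡ i × f b ≡ j
    cut-f cutA = fU , region⇒f (inA (side-far (edge⇒E (Q 0F) 0x)))
      where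
      fU : f U ≡ 2F
      fU = f-inner U-inner λ ¬x ¬y ¬c ¬d → inU ¬x ¬y ¬c ¬d (λ s → side-excl s h-U) (λ s → side-excl s g-U)
    cut-f cutB = proj₁ (cut-f cutA) , region⇒f (inB (Side-≢ sy (≢-sym x≢y)) sy)
      where sy = side-far (edge⇒E (Q 2F) 2y)
    cut-f cutC = fV , region⇒f (inC (Side-≢ Uc (≢-sym x≢z)) (Side-≢ Uc (≢-sym y≢z)) (side-far (edge⇒E (Q 1F) 1c)))
      where
      fV : f V ≡ 4F
      fV = f-inner V-inner λ ¬x ¬y ¬c ¬d → inV ¬x ¬y ¬c ¬d h-V
    cut-f cutD = proj₁ (cut-f cutC) ,
      region⇒f (inD (Side-≢ Ud (≢-sym x≢z)) (Side-≢ Ud (≢-sym y≢z)) (Side-≢ sd (≢-sym c≢d)) sd)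
      where sd = side-far (edge⇒E (Q 3F) 3d)
    cut-f cutH =
      f-inner h₁-inner (λ ¬x ¬y ¬c ¬d → inM ¬x ¬y ¬c ¬d (λ s → proj₁ s refl) g-h₁) ,
      f-inner h₂-inner (λ ¬x ¬y ¬c ¬d → inV ¬x ¬y ¬c ¬d (side-far (edge⇒E (Q 0F) 0h)))
    cut-f cutG =
      f-inner g₁-inner (λ ¬x ¬y ¬c ¬d → inU ¬x ¬y ¬c ¬d (λ s → side-excl s h-g₁) (λ s → proj₁ s refl)) ,
      f-inner g₂-inner (λ ¬x ¬y ¬c ¬d → inM ¬x ¬y ¬c ¬d (λ s → side-excl s h-g₂) (side-far (edge⇒E (Q 0F) 0g)))

    cut-std : ∀ {a b i j} → CutEdge a b i j → stdTree i j ≡ true × stdTree j i ≡ true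
    cut-std cutA = refl , refl
    cut-std cutB = refl , refl
    cut-std cutC = refl , refl
    cut-std cutD = refl , refl
    cut-std cutH = refl , refl
    cut-std cutG = refl , refl

    cut-near : ∀ {a b i j t} → CutEdge a b i j → Region t i → ¬ Side a b t
    cut-near cutA (inU n _ _ _ _ _) = n
    cut-near cutB (inU _ n _ _ _ _) = n
    cut-near cutC (inV _ _ n _ _)   = n
    cut-near cutD (inV _ _ _ n _)   = n
    cut-near cutH (inM _ _ _ _ n _) = n
    cut-near cutG (inU _ _ _ _ _ n) = n

    cut-far : ∀ {a b i j t} → CutEdge a b i j → Region t j → Side a b t
    cut-far cutA (inA s)           = s
    cut-far cutB (inB _ s)         = s
    cut-far cutC (inC _ _ s)       = s
    cut-far cutD (inD _ _ _ s)     = s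
    cut-far cutH (inV _ _ _ _ s)   = s
    cut-far cutG (inM _ _ _ _ _ s) = s

    Cut : Fin m → Fin m → Set
    Cut p q = (∃₂ λ i j → CutEdge p q i j) ⊎ (∃₂ λ i j → CutEdge q p i j)

    same-side : ∀ {a b i j p q} → CutEdge a b i j → E p q →
                does (side? a b p) ≡ does (side? a b q) ⊎ Cut p q
    same-side {a} {b} {p = p} {q} cut e with side? a b p | side? a b q
    ... | yes _ | yes _ = inj₁ refl
    ... | no _  | no _  = inj₁ refl
    ... | no ¬s | yes s with side-crossing e s ¬s
    ...   | refl , refl = inj₂ (inj₁ (_ , _ , cut))
    same-side {a} {b} {p = p} {q} cut e | yes s | no ¬s with side-crossing (E-sym e) s ¬s
    ...   | refl , refl = inj₂ (inj₂ (_ , _ , cut))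

    -- Only the edge that defines a test can have ends on which the test differs. Any edge but the
    -- six leaves all tests, and so the label, unchanged.
    fold-edge : ∀ {p q} → E p q → f p ≡ f q ⊎ Cut p q
    fold-edge e with same-side cutA e | same-side cutB e | same-side cutC e
                   | same-side cutD e | same-side cutH e | same-side cutG e
    ... | inj₂ cut | _ | _ | _ | _ | _ = inj₂ cut
    ... | inj₁ _ | inj₂ cut | _ | _ | _ | _ = inj₂ cut
    ... | inj₁ _ | inj₁ _ | inj₂ cut | _ | _ | _ = inj₂ cut
    ... | inj₁ _ | inj₁ _ | inj₁ _ | inj₂ cut | _ | _ = inj₂ cut
    ... | inj₁ _ | inj₁ _ | inj₁ _ | inj₁ _ | inj₂ cut | _ = inj₂ cut
    ... | inj₁ _ | inj₁ _ | inj₁ _ | inj₁ _ | inj₁ _ | inj₂ cut = inj₂ cut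
    ... | inj₁ a | inj₁ b | inj₁ c | inj₁ d | inj₁ h | inj₁ g
      rewrite a | b | c | d | h | g = inj₁ refl

    fold-hom : ∀ {p q} → E p q → f p ≡ f q ⊎ stdTree (f p) (f q) ≡ true
    fold-hom e with fold-edge e
    ... | inj₁ eq = inj₁ eq
    ... | inj₂ (inj₁ (_ , _ , cut)) rewrite proj₁ (cut-f cut) | proj₂ (cut-f cut) = inj₂ (proj₁ (cut-std cut))
    ... | inj₂ (inj₂ (_ , _ , cut)) rewrite proj₁ (cut-f cut) | proj₂ (cut-f cut) = inj₂ (proj₂ (cut-std cut))

    -- If the first step towards `q` were a cut edge, `q` would lie beyond it and yet in the region
    -- of `p`, against `cut-near` or `cut-far`. Hence the path from `p` to `q` never leaves the
    -- fibre.
    fold-toward : ∀ {p q} → p ≢ q → f p ≡ f q → f p ≡ f (nx p q)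
    fold-toward {p} {q} p≢q eq with fold-edge (proj₁ (nx-spec p≢q))
    ... | inj₁ same = same
    ... | inj₂ (inj₁ (i , j , cut)) = contradiction (≢-sym p≢q , refl)
          (cut-near cut (subst (Region q) (trans (sym eq) (proj₁ (cut-f cut))) (region q)))
    ... | inj₂ (inj₂ (i , j , cut)) = ⊥-elim (side-excl
          (cut-far cut (subst (Region q) (trans (sym eq) (proj₂ (cut-f cut))) (region q))) (≢-sym p≢q , refl))

    fold-fibre : ∀ {p q l} → SimplePath E p q l → f p ≡ f q → Star (λ a b → E a b × f a ≡ f b) p q
    fold-fibre stop _ = ε
    fold-fibre {p} {q} (step e path new) eq =
      (e , same) ◅ fold-fibre path (trans (sym same) eq)
      where
      same = trans (fold-toward (λ { refl → new (end-∈ path) }) eq) (cong f (nx-second e path new (end-∈ path)))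

    Lift : Path T → Fin 7 → Fin 7 → Set
    Lift P i j = ∃₂ λ p q → f p ≡ i × f q ≡ j × edge P p q

    up : ∀ {a b i j} P → CutEdge a b i j → edge P a b → Lift P i j
    up P cut e = _ , _ , proj₁ (cut-f cut) , proj₂ (cut-f cut) , e

    down : ∀ {a b i j} P → CutEdge a b i j → edge P a b → Lift P j i
    down P cut e = _ , _ , proj₂ (cut-f cut) , proj₁ (cut-f cut) , edge-sym P e

    fold-covers : ∀ k {i j} → Edge (stdList k) i j → Lift (Q k) i j
    fold-covers 0F fwd = down (Q 0F) cutA 0x
    fold-covers 0F bwd = up (Q 0F) cutA 0x
    fold-covers 0F (later fwd) = up (Q 0F) cutG 0g
    fold-covers 0F (later bwd) = down (Q 0F) cutG 0g
    fold-covers 0F (later (later fwd)) = up (Q 0F) cutH 0h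
    fold-covers 0F (later (later bwd)) = down (Q 0F) cutH 0h
    fold-covers 0F (later (later (later (later ()))))
    fold-covers 1F fwd = up (Q 1F) cutG 1g
    fold-covers 1F bwd = down (Q 1F) cutG 1g
    fold-covers 1F (later fwd) = up (Q 1F) cutH 1h
    fold-covers 1F (later bwd) = down (Q 1F) cutH 1h
    fold-covers 1F (later (later fwd)) = up (Q 1F) cutC 1c
    fold-covers 1F (later (later bwd)) = down (Q 1F) cutC 1c
    fold-covers 1F (later (later (later (later ()))))
    fold-covers 2F fwd = down (Q 2F) cutB 2y
    fold-covers 2F bwd = up (Q 2F) cutB 2y
    fold-covers 2F (later fwd) = up (Q 2F) cutG 2g
    fold-covers 2F (later bwd) = down (Q 2F) cutG 2g
    fold-covers 2F (later (later (later ())))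
    fold-covers 3F fwd = down (Q 3F) cutB 3y
    fold-covers 3F bwd = up (Q 3F) cutB 3y
    fold-covers 3F (later fwd) = up (Q 3F) cutG 3g
    fold-covers 3F (later bwd) = down (Q 3F) cutG 3g
    fold-covers 3F (later (later fwd)) = up (Q 3F) cutH 3h
    fold-covers 3F (later (later bwd)) = down (Q 3F) cutH 3h
    fold-covers 3F (later (later (later fwd))) = up (Q 3F) cutD 3d
    fold-covers 3F (later (later (later bwd))) = down (Q 3F) cutD 3d
    fold-covers 3F (later (later (later (later (later ())))))
    fold-covers 4F fwd = up (Q 4F) cutH 4h
    fold-covers 4F bwd = down (Q 4F) cutH 4h
    fold-covers 4F (later fwd) = up (Q 4F) cutD 4d
    fold-covers 4F (later bwd) = down (Q 4F) cutD 4d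
    fold-covers 4F (later (later (later ())))

  skeleton⇒fold : ∀ {Q} → Skeleton Q → Fold T Q
  skeleton⇒fold sk = record
    { f = f ; hom = fold-hom ; covers = fold-covers
    ; fibres = λ p q → fold-fibre (proj₂ (simplePath p q)) }
    where open SkeletonFold sk

-- Contracting one edge of a tree

does⇒ : ∀ {A : Set} (d : Dec A) → does d ≡ true → A
does⇒ (yes a) _ = a

module _ {A : Set} {R : A → A → Set} where

  Star⇒walk : ∀ {a b} → Star R a b → a ≡ b ⊎ ∃ λ l → Linked R (a ∷ l ++ [ b ])
  Star⇒walk ε = inj₁ refl
  Star⇒walk (r ◅ s) with Star⇒walk s
  ... | inj₁ refl    = inj₂ ([] , r ∷ [-])
  ... | inj₂ (l , w) = inj₂ (_ ∷ l , r ∷ w)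

  walk⇒Star : ∀ {a b} l → Linked R (a ∷ l ++ [ b ]) → Star R a b
  walk⇒Star []      (r ∷ _) = r ◅ ε
  walk⇒Star (_ ∷ l) (r ∷ w) = r ◅ walk⇒Star l w

  -- A cycle through an edge would have to cross the two-colouring of that edge a second time. In
  -- this form acyclicity passes to the contracted tree, whose colourings come from `Side`.
  bridges⇒acyclic : (∀ {a b} → R a b → R b a) →
    (∀ {p q} → R p q → ∃ λ (S : A → Bool) → S p ≡ false × S q ≡ true ×
       (∀ {c d} → R c d → S c ≡ false → S d ≡ true → c ≡ p × d ≡ q)) →
    ∀ x l y → l ≢ [] → Unique (x ∷ l ++ [ y ]) → Linked R (x ∷ l ++ [ y ]) → ¬ R y x
  bridges⇒acyclic R-sym bridge x [] y l≢[] = contradiction refl l≢[]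
  bridges⇒acyclic R-sym bridge x (z ∷ l) y _ (x≢ ∷ z≢ ∷ _) (xz ∷ w) yx with bridge yx
  ... | S , Sy , Sx , only = go (S z) refl
    where
    leave : ∀ a l → Linked R (a ∷ l ++ [ y ]) → S a ≡ true → x ∈ a ∷ l ++ [ y ]
    leave a [] (r ∷ _) Sa = here (sym (proj₂ (only (R-sym r) Sy Sa)))
    leave a (b ∷ l) (r ∷ w) Sa with S b in Sb
    ... | true  = there (leave b l w Sb)
    ... | false = here (sym (proj₂ (only (R-sym r) Sb Sa)))
    go : ∀ v → S z ≡ v → ⊥
    go true  Sz = All¬⇒¬Any x≢ (leave z l w Sz)
    go false Sz = All¬⇒¬Any z≢ (∈-++⁺ʳ l (here (proj₁ (only (R-sym xz) Sz Sx))))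

Edge-long : ∀ {A : Set} {l} {a b : A} → Edge l a b → 2 ≤ length l
Edge-long fwd = s≤s (s≤s z≤n)
Edge-long bwd = s≤s (s≤s z≤n)
Edge-long {l = _ ∷ []} (later ())
Edge-long {l = _ ∷ _ ∷ _} (later _) = s≤s (s≤s z≤n)

module Contraction {m : ℕ} (T : Tree (suc m)) {x y : Fin (suc m)} (xy : Tree.E T x y) where

  open Tree T using (E; graph; connected)
  open TreeTheory T
  open PathTheory T

  Same : Fin (suc m) → Fin (suc m) → Set
  Same a b = a ≡ b ⊎ (a ≡ x × b ≡ y) ⊎ (a ≡ y × b ≡ x)

  private
    -- Contraction sends `y` to `x` and then drops `y` from the numbering, so that `punchIn y` is a
    -- section of it.
    redirect : Fin (suc m) → Fin (suc m)
    redirect t with t ≟ y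
    ... | yes _ = x
    ... | no _  = t

    redirect-≢ : ∀ t → y ≢ redirect t
    redirect-≢ t with t ≟ y
    ... | yes _  = ≢-sym (E⇒≢ xy)
    ... | no t≢y = ≢-sym t≢y

  abstract

    π : Fin (suc m) → Fin m
    π t = punchOut (redirect-≢ t)

    ι : Fin m → Fin (suc m)
    ι = punchIn y

    π-ι : ∀ s → π (ι s) ≡ s
    π-ι s = punchIn-injective y _ _ (trans (punchIn-punchOut (redirect-≢ (ι s))) fixed)
      where
      fixed : redirect (ι s) ≡ ι s
      fixed with ι s ≟ y
      ... | yes eq = contradiction eq (punchInᵢ≢i y s)
      ... | no _   = refl

    π-same : ∀ {a b} → π a ≡ π b → Same a b
    π-same {a} {b} eq = go (trans (sym (punchIn-punchOut (redirect-≢ a)))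
                              (trans (cong (punchIn y) eq) (punchIn-punchOut (redirect-≢ b))))
      where
      go : redirect a ≡ redirect b → Same a b
      go eq with a ≟ y | b ≟ y
      ... | yes a≡y | yes b≡y = inj₁ (trans a≡y (sym b≡y))
      ... | yes a≡y | no _    = inj₂ (inj₂ (a≡y , sym eq))
      ... | no _    | yes b≡y = inj₂ (inj₁ (eq , b≡y))
      ... | no _    | no _    = inj₁ eq

    π-glues : π x ≡ π y
    π-glues = punchOut-cong y (trans rx (sym ry))
      where
      rx : redirect x ≡ x
      rx with x ≟ y
      ... | yes _ = refl
      ... | no _  = refl
      ry : redirect y ≡ x
      ry with y ≟ y
      ... | yes _ = refl
      ... | no ne = contradiction refl ne

  same-π : ∀ {a b} → Same a b → π a ≡ π b
  same-π (inj₁ refl)                  = refl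
  same-π (inj₂ (inj₁ (refl , refl))) = π-glues
  same-π (inj₂ (inj₂ (refl , refl))) = sym π-glues

  same⇒E : ∀ {a b} → a ≢ b → Same a b → E a b
  same⇒E a≢b (inj₁ a≡b) = contradiction a≡b a≢b
  same⇒E a≢b (inj₂ (inj₁ (refl , refl))) = xy
  same⇒E a≢b (inj₂ (inj₂ (refl , refl))) = E-sym xy

  E′ : Fin m → Fin m → Set
  E′ a′ b′ = ∃₂ λ a b → π a ≡ a′ × π b ≡ b′ × E a b × a′ ≢ b′

  E′-sym : ∀ {a b} → E′ a b → E′ b a
  E′-sym (a , b , p , q , e , ne) = b , a , q , p , E-sym e , ≢-sym ne

  E′? : ∀ a b → Dec (E′ a b)
  E′? a′ b′ = any? λ a → any? λ b →
    π a ≟ a′ ×-dec π b ≟ b′ ×-dec SimpleGraph.adj graph a b Bool.≟ true ×-dec ¬? (a′ ≟ b′)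

  graph′ : SimpleGraph m
  graph′ = record
    { adj      = λ a b → does (E′? a b)
    ; loopless = λ a → dec-false (E′? a a) λ (_ , _ , _ , _ , _ , ne) → ne refl
    ; symm     = λ a b → does-⇔ (mk⇔ E′-sym E′-sym) (E′? a b) (E′? b a)
    }

  to-E′ : ∀ {a b} → Adj graph′ a b → E′ a b
  to-E′ {a} {b} = does⇒ (E′? a b)

  from-E′ : ∀ {a b} → E′ a b → Adj graph′ a b
  from-E′ {a} {b} = dec-true (E′? a b)

  π-Star : ∀ {a b} → Star E a b → Star (Adj graph′) (π a) (π b)
  π-Star ε = ε
  π-Star {a} {b} (_◅_ {j = c} e s) with π a ≟ π c
  ... | yes eq = subst (λ p → Star (Adj graph′) p (π b)) (sym eq) (π-Star s)
  ... | no ne  = from-E′ (a , c , refl , refl , e , ne) ◅ π-Star s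

  joined′ : ∀ a b → Star (Adj graph′) a b
  joined′ a b with connected (ι a) (ι b)
  ... | inj₁ eq      = subst (Star _ a) (trans (sym (π-ι a)) (trans (cong π eq) (π-ι b))) ε
  ... | inj₂ (l , w) = subst₂ (Star _) (π-ι a) (π-ι b) (π-Star (walk⇒Star l w))

  -- Sides of an edge other than xy do not separate x from y, so they survive the contraction.
  side-π : ∀ {a b s t} → E a b → π a ≢ π b → π s ≡ π t → Side a b s → Side a b t
  side-π {a} {b} {s} {t} e ne eq ss with s ≟ t
  ... | yes refl = ss
  ... | no s≢t with side? a b t
  ...   | yes st = st
  ...   | no ¬st with side-crossing (same⇒E (≢-sym s≢t) (π-same (sym eq))) ss ¬st
  ...     | refl , refl = contradiction (sym eq) ne

  -- The colouring is the side of a preimage of the edge, evaluated through the section `ι`.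
  bridge′ : ∀ {p q} → Adj graph′ p q → ∃ λ (S : Fin m → Bool) → S p ≡ false × S q ≡ true ×
       (∀ {c d} → Adj graph′ c d → S c ≡ false → S d ≡ true → c ≡ p × d ≡ q)
  bridge′ {p} {q} r with to-E′ r
  ... | a , b , refl , refl , e , ne = S , dec-false (side? a b (ι (π a))) ¬Sp , dec-true (side? a b (ι (π b))) Sq , only
    where
    S : Fin m → Bool
    S t = does (side? a b (ι t))
    Sq : Side a b (ι (π b))
    Sq = side-π e ne (sym (π-ι (π b))) (side-far e)
    ¬Sp : ¬ Side a b (ι (π a))
    ¬Sp s = proj₁ (side-π e ne (π-ι (π a)) s) refl
    only : ∀ {c d} → Adj graph′ c d → S c ≡ false → S d ≡ true → c ≡ π a × d ≡ π b
    only cd Sc Sd with to-E′ cd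
    ... | c , d , refl , refl , e′ , _ with side-crossing {a} {b} e′
             (side-π e ne (π-ι (π d)) (does⇒ (side? a b (ι (π d))) Sd))
             (λ s → true≢false (trans (sym (dec-true (side? a b (ι (π c))) (side-π e ne (sym (π-ι (π c))) s))) Sc))
      where
      true≢false : true ≢ false
      true≢false ()
    ...   | refl , refl = refl , refl

  T′ : Tree m
  T′ = record
    { graph     = graph′
    ; connected = λ a b → Star⇒walk (joined′ a b)
    ; acyclic   = bridges⇒acyclic (λ {a} {b} e → trans (SimpleGraph.symm graph′ b a) e) bridge′
    }

  -- The field `source` serves to show that the contracted list has no repetitions.
  record Shrunk (a b : Fin (suc m)) (l : List (Fin (suc m))) : Set where
    field
      list   : List (Fin m)
      path   : SimplePath (Adj graph′) (π a) (π b) list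
      source : ∀ {s} → s ∈ list → ∃ λ t → t ∈ l × π t ≡ s
      to     : ∀ {p q} → Edge l p q → π p ≢ π q → Edge list (π p) (π q)
      from   : ∀ {p′ q′} → Edge list p′ q′ → ∃₂ λ p q → π p ≡ p′ × π q ≡ q′ × Edge l p q × p′ ≢ q′

  shrink : ∀ {a b l} → SimplePath E a b l → Shrunk a b l
  shrink {a} stop = record
    { list = π a ∷ [] ; path = stop ; source = λ { (here refl) → a , here refl , refl }
    ; to = λ { (later ()) _ } ; from = λ { (later ()) } }
  shrink (step {a} {b} {c} {l} e p new) with π a ≟ π b | shrink p
  ... | yes eq | S = record
        { list = list ; path = subst (λ s → SimplePath (Adj graph′) s (π c) list) (sym eq) path
        ; source = λ i → let (t , t∈ , πt) = source i in t , there t∈ , πt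
        ; to = to′ ; from = λ i → let (p , q , πp , πq , i′ , ne) = from i in p , q , πp , πq , later i′ , ne }
    where
    open Shrunk S
    to′ : ∀ {p q} → Edge (a ∷ l) p q → π p ≢ π q → Edge list (π p) (π q)
    to′ i ne with SimplePath-head p
    to′ fwd       ne | _ , refl = contradiction eq ne
    to′ bwd       ne | _ , refl = contradiction (sym eq) ne
    to′ (later i) ne | _        = to i ne
  ... | no ne | S = record
        { list = π a ∷ list ; path = step (from-E′ (a , b , refl , refl , e , ne)) path new′
        ; source = λ { (here refl) → a , here refl , refl
                     ; (there i) → let (t , t∈ , πt) = source i in t , there t∈ , πt }
        ; to = to′ ; from = from′ }
    where
    open Shrunk S
    -- Two vertices of a simple path that get identified are adjacent, hence consecutive.
    new′ : π a ∉ list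
    new′ i with source i
    ... | t , t∈ , πt = ne (trans (sym πt) (cong π (trans (sym (nx-nbr (same⇒E a≢t (π-same (sym πt)))))
                                                         (nx-second e p new t∈))))
      where
      a≢t : a ≢ t
      a≢t refl = new t∈
    to′ : ∀ {p q} → Edge (a ∷ l) p q → π p ≢ π q → Edge (π a ∷ list) (π p) (π q)
    to′ i _ with SimplePath-head p | SimplePath-head path
    to′ fwd       _ | _ , refl | _ , refl = fwd
    to′ bwd       _ | _ , refl | _ , refl = bwd
    to′ (later i) n | _        | _        = later (to i n)
    from′ : ∀ {p′ q′} → Edge (π a ∷ list) p′ q′ →
            ∃₂ λ p q → π p ≡ p′ × π q ≡ q′ × Edge (a ∷ l) p q × p′ ≢ q′
    from′ i with SimplePath-head p | SimplePath-head path
    from′ fwd       | _ , refl | _ , refl = a , b , refl , refl , fwd , ne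
    from′ bwd       | _ , refl | _ , refl = b , a , refl , refl , bwd , ≢-sym ne
    from′ (later i) | _        | _        =
      let (p , q , πp , πq , i′ , ne′) = from i in p , q , πp , πq , later i′ , ne′

  module _ (P : Path T) (survives : ∃₂ λ a b → edge P a b × π a ≢ π b) where

    private
      S = shrink (proj₂ (proj₂ (path-simple P)))
      open Shrunk S

    contractPath : Path T′
    contractPath = record
      { verts  = list
      ; chain  = SimplePath⇒Linked path
      ; simple = SimplePath⇒Unique path
      ; long   = Edge-long (to (EdgeIn⇒Edge (proj₁ (proj₂ (proj₂ survives)))) (proj₂ (proj₂ (proj₂ survives))))
      }

    contract-edge : ∀ a′ b′ → edge contractPath a′ b′ ⇔
      (∃₂ λ a b → π a ≡ a′ × π b ≡ b′ × edge P a b × a′ ≢ b′)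
    contract-edge a′ b′ = mk⇔
      (λ e → let (p , q , πp , πq , i , ne) = from (EdgeIn⇒Edge e) in p , q , πp , πq , Edge⇒EdgeIn i , ne)
      (λ { (a , b , refl , refl , e , ne) → Edge⇒EdgeIn (to (EdgeIn⇒Edge e) ne) })

  module _ {n : ℕ} (P : Fin n → Path T) (survive : ∀ v → ∃₂ λ a b → edge (P v) a b × π a ≢ π b) where

    P′ : Fin n → Path T′
    P′ v = contractPath (P v) (survive v)

    contract : Contract (record { m = suc m ; T = T ; P = P }) (record { m = m ; T = T′ ; P = P′ })
    contract = x , y , xy , π , (λ b → ι b , π-ι b) , (λ a b → mk⇔ π-same same-π) ,
      (λ a b → mk⇔ to-E′ from-E′) , λ v → contract-edge (P v) (survive v)

-- Facts about the standard tree, by enumeration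

std-nonempty : ∀ k → ∃₂ λ i j → Edge (stdList k) i j
std-nonempty 0F = _ , _ , fwd
std-nonempty 1F = _ , _ , fwd
std-nonempty 2F = _ , _ , fwd
std-nonempty 3F = _ , _ , fwd
std-nonempty 4F = _ , _ , fwd

abstract

  std-irrefl : ∀ k i → ¬ Edge (stdList k) i i
  std-irrefl = from-yes (all? λ k → all? λ i → ¬? (Edge? _≟_ (stdList k) i i))

  std-occurs : ∀ i → ∃₂ λ k j → Edge (stdList k) i j
  std-occurs = from-yes (all? λ i → any? λ k → any? λ j → Edge? _≟_ (stdList k) i j)

  std-on-path : ∀ k i → i ∈ stdList k → ∃ λ j → Edge (stdList k) i j
  std-on-path = from-yes (all? λ k → all? λ i → (i ∈? stdList k) →-dec (any? λ j → Edge? _≟_ (stdList k) i j))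
    where open DecMembership (_≟_ {7}) using (_∈?_)

  std-tree-edge : ∀ i j → stdTree i j ≡ true → ∃ λ k → Edge (stdList k) i j
  std-tree-edge = from-yes (all? λ i → all? λ j →
    (stdTree i j Bool.≟ true) →-dec (any? λ k → Edge? _≟_ (stdList k) i j))

  std-reverse : ∀ k i j → (Edge (reverse (stdList k)) i j → Edge (stdList k) i j) ×
                          (Edge (stdList k) i j → Edge (reverse (stdList k)) i j)
  std-reverse = from-yes (all? λ k → all? λ i → all? λ j →
    (Edge? _≟_ (reverse (stdList k)) i j →-dec Edge? _≟_ (stdList k) i j) ×-dec
    (Edge? _≟_ (stdList k) i j →-dec Edge? _≟_ (reverse (stdList k)) i j))

StdEdge : Fin 7 → Fin 7 → Set
StdEdge i j = stdTree i j ≡ true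

std-first std-last : Fin 5 → Fin 7
std-first 0F = 0F
std-first 1F = 2F
std-first 2F = 1F
std-first 3F = 1F
std-first 4F = 3F
std-last 0F = 4F
std-last 1F = 5F
std-last 2F = 3F
std-last 3F = 6F
std-last 4F = 6F

-- Both orientations are listed because a representation may run through a standard path either way.
std-path : ∀ k → SimplePath StdEdge (std-first k) (std-last k) (stdList k) ×
                 SimplePath StdEdge (std-last k) (std-first k) (reverse (stdList k))
std-path = λ where
    0F → r ⟫ r ⟫ r ⟫ stop , r ⟫ r ⟫ r ⟫ stop
    1F → r ⟫ r ⟫ r ⟫ stop , r ⟫ r ⟫ r ⟫ stop
    2F → r ⟫ r ⟫ stop , r ⟫ r ⟫ stop
    3F → r ⟫ r ⟫ r ⟫ r ⟫ stop , r ⟫ r ⟫ r ⟫ r ⟫ stop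
    4F → r ⟫ r ⟫ stop , r ⟫ r ⟫ stop
  where
  open DecMembership (_≟_ {7}) using (_∈?_)
  infixr 5 _⟫_
  r : true ≡ true
  r = refl
  _⟫_ : ∀ {a b c l} → StdEdge a b → SimplePath StdEdge b c l → {new : False (a ∈? l)} →
        SimplePath StdEdge a c (a ∷ l)
  _⟫_ e p {new} = step e p (toWitnessFalse new)

std-toℕ : ∀ k → stdPath k ≡ map toℕ (stdList k)
std-toℕ 0F = refl
std-toℕ 1F = refl
std-toℕ 2F = refl
std-toℕ 3F = refl
std-toℕ 4F = refl

module _ {A B : Set} (h : A → B) where

  Edge-map⁺ : ∀ {l a b} → Edge l a b → Edge (map h l) (h a) (h b)
  Edge-map⁺ fwd       = fwd
  Edge-map⁺ bwd       = bwd
  Edge-map⁺ (later e) = later (Edge-map⁺ e)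

  Edge-map⁻ : (∀ {a b} → h a ≡ h b → a ≡ b) → ∀ {a b} l → Edge (map h l) (h a) (h b) → Edge l a b
  Edge-map⁻ inj l e = go l e refl refl
    where
    go : ∀ l {a b a′ b′} → Edge (map h l) a′ b′ → a′ ≡ h a → b′ ≡ h b → Edge l a b
    go (_ ∷ _ ∷ _) fwd p q with inj p | inj q
    ... | refl | refl = fwd
    go (_ ∷ _ ∷ _) bwd p q with inj p | inj q
    ... | refl | refl = bwd
    go (_ ∷ l) (later e) p q = later (go l e p q)

EdgeIn-std : ∀ k {i j} → EdgeIn (stdPath k) (toℕ i) (toℕ j) ⇔ Edge (stdList k) i j
EdgeIn-std k {i} {j} = mk⇔
  (λ e → Edge-map⁻ toℕ toℕ-injective (stdList k)
           (EdgeIn⇒Edge (subst (λ l → EdgeIn l (toℕ i) (toℕ j)) (std-toℕ k) e)))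
  (λ e → subst (λ l → EdgeIn l (toℕ i) (toℕ j)) (sym (std-toℕ k)) (Edge⇒EdgeIn (Edge-map⁺ toℕ e)))

-- Shortening paths

module _ {A : Set} where

  Unique-++⁻ˡ : ∀ l {r : List A} → Unique (l ++ r) → Unique l
  Unique-++⁻ˡ []      _        = []
  Unique-++⁻ˡ (_ ∷ l) (n ∷ ns) = ++⁻ˡ l n ∷ Unique-++⁻ˡ l ns

  Linked-++⁻ˡ : ∀ {R : A → A → Set} l {r : List A} → Linked R (l ++ r) → Linked R l
  Linked-++⁻ˡ []          _        = []
  Linked-++⁻ˡ (_ ∷ [])    _        = [-]
  Linked-++⁻ˡ (_ ∷ _ ∷ l) (r ∷ rs) = r ∷ Linked-++⁻ˡ (_ ∷ l) rs

  Unique-tail : ∀ {a} {l : List A} → Unique (a ∷ l) → Unique l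
  Unique-tail (_ ∷ u) = u

  Unique-last : ∀ l {c : A} → Unique (l ++ [ c ]) → c ∉ l
  Unique-last (a ∷ l) (n ∷ _) (here refl) = All¬⇒¬Any n (∈-++⁺ʳ l (here refl))
  Unique-last (a ∷ l) (_ ∷ u) (there i)   = Unique-last l u i

  Edge-++⁺ˡ : ∀ {l r} {a b : A} → Edge l a b → Edge (l ++ r) a b
  Edge-++⁺ˡ fwd       = fwd
  Edge-++⁺ˡ bwd       = bwd
  Edge-++⁺ˡ (later e) = later (Edge-++⁺ˡ e)

  Edge-++⁺ʳ : ∀ r {l} {a b : A} → Edge l a b → Edge (r ++ l) a b
  Edge-++⁺ʳ []      e = e
  Edge-++⁺ʳ (_ ∷ r) e = later (Edge-++⁺ʳ r e)

  Edge-snoc⁻ : ∀ l {d c a b : A} → Edge (l ++ d ∷ c ∷ []) a b →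
               Edge (l ++ d ∷ []) a b ⊎ (a ≡ c × b ≡ d) ⊎ (a ≡ d × b ≡ c)
  Edge-snoc⁻ [] fwd = inj₂ (inj₂ (refl , refl))
  Edge-snoc⁻ [] bwd = inj₂ (inj₁ (refl , refl))
  Edge-snoc⁻ [] (later (later ()))
  Edge-snoc⁻ (_ ∷ [])    fwd = inj₁ fwd
  Edge-snoc⁻ (_ ∷ [])    bwd = inj₁ bwd
  Edge-snoc⁻ (_ ∷ _ ∷ _) fwd = inj₁ fwd
  Edge-snoc⁻ (_ ∷ _ ∷ _) bwd = inj₁ bwd
  Edge-snoc⁻ (_ ∷ l) (later e) with Edge-snoc⁻ l e
  ... | inj₁ e′ = inj₁ (later e′)
  ... | inj₂ eq = inj₂ eq

  snoc-view : ∀ (l : List A) → 2 ≤ length l → ∃₂ λ l′ d → l ≡ l′ ++ [ d ]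
  snoc-view (a ∷ [])         (s≤s ())
  snoc-view (a ∷ b ∷ [])     _ = [ a ] , b , refl
  snoc-view (a ∷ l@(_ ∷ _ ∷ _)) _ with snoc-view l (s≤s (s≤s z≤n))
  ... | l′ , d , eq = a ∷ l′ , d , cong (a ∷_) eq

module Trim {n m : ℕ} (T : Tree m) where

  open Tree T using (E)
  open TreeTheory T
  open PathTheory T
  open Path using (verts; chain; simple; long)

  rep : (Fin n → Path T) → Rep n
  rep P = record { m = m ; T = T ; P = P }

  update : (Fin n → Path T) → Fin n → Path T → Fin n → Path T
  update P v Q w with w ≟ v
  ... | yes _ = Q
  ... | no _  = P w

  update-at : ∀ P v Q → update P v Q v ≡ Q
  update-at P v Q with v ≟ v
  ... | yes _ = refl
  ... | no ne = contradiction refl ne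

  update-off : ∀ P v Q {w} → w ≢ v → update P v Q w ≡ P w
  update-off P v Q {w} w≢v with w ≟ v
  ... | yes eq = contradiction eq w≢v
  ... | no _   = refl

  remove : ∀ P v Q {x y} → EndEdge (verts (P v)) x y →
    (∀ a b → edge Q a b ⇔ (edge (P v) a b × ¬ ((a ≡ x × b ≡ y) ⊎ (a ≡ y × b ≡ x)))) →
    Minify (rep P) (rep (update P v Q))
  remove P v Q {x} {y} end equiv = inj₂ (↔-id _ , (λ _ _ → refl) , v , x , y , end , edges)
    where
    edges : ∀ w a b → edge (update P v Q w) a b ⇔
            (edge (P w) a b × (w ≡ v → ¬ ((a ≡ x × b ≡ y) ⊎ (a ≡ y × b ≡ x))))
    edges w a b with w ≟ v
    ... | yes refl = mk⇔ (λ e → map₂ (λ n _ → n) (Equivalence.to (equiv a b) e))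
                         (λ (e , n) → Equivalence.from (equiv a b) (e , n refl))
    ... | no w≢v   = mk⇔ (λ e → e , λ eq → contradiction eq w≢v) proj₁

  remove-first : ∀ P v Q {c} → verts (P v) ≡ c ∷ verts Q → Minify (rep P) (rep (update P v Q))
  remove-first P v Q {c} eq with verts Q in eqQ | long Q | simple (P v)
  ... | d ∷ l | _ | un = remove P v Q (inj₁ (l , eq)) λ a b → mk⇔ (to a b) (from a b)
    where
    c∉ : c ∉ d ∷ l
    c∉ with subst Unique eq un
    ... | n ∷ _ = All¬⇒¬Any n
    to : ∀ a b → edge Q a b → edge (P v) a b × ¬ ((a ≡ c × b ≡ d) ⊎ (a ≡ d × b ≡ c))
    to a b e = Edge⇒EdgeIn (subst (λ l → Edge l a b) (sym eq) (later e′)) ,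
      λ { (inj₁ (refl , _)) → c∉ (Edge-∈ e′) ; (inj₂ (_ , refl)) → c∉ (Edge-∈ (Edge-sym e′)) }
      where
      e′ : Edge (d ∷ l) a b
      e′ = EdgeIn⇒Edge (subst (λ l → EdgeIn l a b) eqQ e)
    from : ∀ a b → edge (P v) a b × ¬ ((a ≡ c × b ≡ d) ⊎ (a ≡ d × b ≡ c)) → edge Q a b
    from a b (e , ne) with subst (λ l → Edge l a b) eq (EdgeIn⇒Edge e)
    ... | fwd      = contradiction (inj₁ (refl , refl)) ne
    ... | bwd      = contradiction (inj₂ (refl , refl)) ne
    ... | later e′ = Edge⇒EdgeIn (subst (λ l → Edge l a b) (sym eqQ) e′)

  remove-last : ∀ P v Q {c} → verts (P v) ≡ verts Q ++ [ c ] → Minify (rep P) (rep (update P v Q))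
  remove-last P v Q {c} eq with snoc-view (verts Q) (long Q)
  ... | l , d , eqQ = remove P v Q (inj₂ (l , eq′)) λ a b → mk⇔ (to a b) (from a b)
    where
    eq′ : verts (P v) ≡ l ++ d ∷ c ∷ []
    eq′ = trans eq (trans (cong (_++ [ c ]) eqQ) (++-assoc l [ d ] [ c ]))
    c∉ : c ∉ verts Q
    c∉ = Unique-last (verts Q) (subst Unique eq (simple (P v)))
    to : ∀ a b → edge Q a b → edge (P v) a b × ¬ ((a ≡ c × b ≡ d) ⊎ (a ≡ d × b ≡ c))
    to a b e = Edge⇒EdgeIn (subst (λ l → Edge l a b) (sym eq) (Edge-++⁺ˡ (EdgeIn⇒Edge e))) ,
      λ { (inj₁ (refl , _)) → c∉ (edge⇒∋ Q e) ; (inj₂ (_ , refl)) → c∉ (edge⇒∋ʳ Q e) }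
    from : ∀ a b → edge (P v) a b × ¬ ((a ≡ c × b ≡ d) ⊎ (a ≡ d × b ≡ c)) → edge Q a b
    from a b (e , ne) with Edge-snoc⁻ l (subst (λ l → Edge l a b) eq′ (EdgeIn⇒Edge e))
    ... | inj₁ e′ = Edge⇒EdgeIn (subst (λ l → Edge l a b) (sym eqQ) e′)
    ... | inj₂ eq = contradiction eq ne

  Trimmed : (Fin n → Path T) → Fin n → List (Fin m) → Set
  Trimmed P v l = ∃ λ P′ → Star Minify (rep P) (rep P′) × verts (P′ v) ≡ l × (∀ {w} → w ≢ v → P′ w ≡ P w)

  then-trim : ∀ {P P₁ v l} → Star Minify (rep P) (rep P₁) → (∀ {w} → w ≢ v → P₁ w ≡ P w) →
              Trimmed P₁ v l → Trimmed P v l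
  then-trim s same (P′ , s′ , eq , same′) = P′ , s ◅◅ s′ , eq , λ ne → trans (same′ ne) (same ne)

  trim-front : ∀ pre P v l → 2 ≤ length l → verts (P v) ≡ pre ++ l → Trimmed P v l
  trim-front [] P v l len eq = P , ε , eq , λ _ → refl
  trim-front (c ∷ pre) P v l len eq =
    then-trim {v = v} (remove-first P v Q eq ◅ ε) (update-off P v Q)
      (trim-front pre (update P v Q) v l len (cong verts (update-at P v Q)))
    where
    longer : ∀ pre → 2 ≤ length (pre ++ l)
    longer []        = len
    longer (_ ∷ pre) with pre ++ l | longer pre
    ... | _ ∷ _ | _ = s≤s (s≤s z≤n)
    Q : Path T
    Q = record { verts = pre ++ l ; chain = Linked.tail (subst (Linked E) eq (chain (P v)))
               ; simple = Unique-tail (subst Unique eq (simple (P v))) ; long = longer pre }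

  -- The list must lose its outer end first, so `post` goes before `c`.
  trim-back : ∀ post P v l → 2 ≤ length l → verts (P v) ≡ l ++ post → Trimmed P v l
  trim-back [] P v l len eq = P , ε , trans eq (++-identityʳ l) , λ _ → refl
  trim-back (c ∷ post) P v l len eq
    with trim-back post P v (l ++ [ c ]) (longer l len) (trans eq (sym (++-assoc l [ c ] post)))
    where
    longer : ∀ l → 2 ≤ length l → 2 ≤ length (l ++ [ c ])
    longer (_ ∷ _ ∷ _) _ = s≤s (s≤s z≤n)
    longer (_ ∷ [])    _ = s≤s (s≤s z≤n)
  ... | P₁ , s , eq₁ , same = then-trim {v = v} s same
        (update P₁ v Q , remove-last P₁ v Q eq₁ ◅ ε , cong verts (update-at P₁ v Q) , update-off P₁ v Q)
    where
    Q : Path T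
    Q = record { verts = l ; chain = Linked-++⁻ˡ l (subst (Linked E) eq (chain (P v)))
               ; simple = Unique-++⁻ˡ l (subst Unique eq (simple (P v))) ; long = len }

  Infix : List (Fin m) → List (Fin m) → Set
  Infix l l′ = ∃₂ λ pre post → l′ ≡ pre ++ l ++ post

  trim : ∀ P v l → 2 ≤ length l → Infix l (verts (P v)) → Trimmed P v l
  trim P v l len (pre , post , eq) with trim-front pre P v (l ++ post) (longer l len) eq
    where
    longer : ∀ l → 2 ≤ length l → 2 ≤ length (l ++ post)
    longer (_ ∷ _ ∷ _) _ = s≤s (s≤s z≤n)
    longer (_ ∷ [])    (s≤s ())
  ... | P₁ , s , eq₁ , same = then-trim {v = v} s same (trim-back post P₁ v l len eq₁)

  abstract

    trim-all : ∀ (target : Fin n → List (Fin m)) → (∀ v → 2 ≤ length (target v)) →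
      ∀ P → (∀ v → Infix (target v) (verts (P v))) →
      ∃ λ P′ → Star Minify (rep P) (rep P′) × (∀ v → verts (P′ v) ≡ target v)
    trim-all target len P inf with go (allFin n)
      where
      go : ∀ vs → ∃ λ P′ → Star Minify (rep P) (rep P′) ×
             (∀ v → v ∈ vs → verts (P′ v) ≡ target v) × (∀ v → Infix (target v) (verts (P′ v)))
      go [] = P , ε , (λ _ ()) , inf
      go (v ∷ vs) with go vs
      ... | P₁ , s₁ , done₁ , inf₁ with trim P₁ v (target v) (len v) (inf₁ v)
      ...   | P₂ , s₂ , eq , same = P₂ , s₁ ◅◅ s₂ , done , inf₂
        where
        done : ∀ w → w ∈ v ∷ vs → verts (P₂ w) ≡ target w
        done w i with w ≟ v
        done w i           | yes refl = eq
        done w (here refl) | no w≢v   = contradiction refl w≢v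
        done w (there i)   | no w≢v   = trans (cong verts (same w≢v)) (done₁ w i)
        inf₂ : ∀ w → Infix (target w) (verts (P₂ w))
        inf₂ w with w ≟ v
        ... | yes refl = [] , [] , trans eq (sym (++-identityʳ _))
        ... | no w≢v   = subst (λ p → Infix (target w) (verts p)) (sym (same w≢v)) (inf₁ w)
    ... | P′ , s , done , _ = P′ , s , λ v → done v (∈-allFin v)

  prefix : ∀ {a b c l} → SimplePath E a b l → c ∈ l →
           ∃₂ λ mid post → l ≡ mid ++ post × SimplePath E a c mid
  prefix stop (here refl) = _ , [] , refl , stop
  prefix (step _ _ _) (here refl) = _ , _ , refl , stop
  prefix (step {a = a} e p new) (there i) with prefix p i
  ... | mid , post , refl , q = a ∷ mid , post , refl , step e q (new ∘ ∈-++⁺ˡ)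

  segment : ∀ {s t l a b} → SimplePath E s t l → a ∈ l → b ∈ l →
            ∃ λ mid → Infix mid l × (SimplePath E a b mid ⊎ SimplePath E b a mid)
  segment stop (here refl) (here refl) = _ , ([] , [] , refl) , inj₁ stop
  segment p@(step _ _ _) (here refl) j with prefix p j
  ... | mid , post , eq , q = mid , ([] , post , eq) , inj₁ q
  segment p@(step _ _ _) (there i) (here refl) with prefix p (there i)
  ... | mid , post , eq , q = mid , ([] , post , eq) , inj₂ q
  segment (step {a = s} _ p _) (there i) (there j) with segment p i j
  ... | mid , (pre , post , refl) , q = mid , (s ∷ pre , post , refl) , q

  Standard : (Fin 7 → Fin m) → Fin 5 → List (Fin m) → Set
  Standard τ k l = l ≡ map τ (stdList k) ⊎ l ≡ map τ (reverse (stdList k))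

  module _ {τ : Fin 7 → Fin m} (τ-inj : ∀ {i j} → τ i ≡ τ j → i ≡ j)
           (τ-E : ∀ {i j} → StdEdge i j → E (τ i) (τ j)) where

    -- A simple path in a tree is determined by its ends, so the stretch of `P` between these two
    -- vertices is the image of the standard path, in one of its orientations.
    standard-segment : ∀ k P → P ∋ τ (std-first k) → P ∋ τ (std-last k) →
                       ∃ λ l → Infix l (verts P) × Standard τ k l
    standard-segment k P a∈ b∈ with segment (proj₂ (proj₂ (path-simple P))) a∈ b∈
    ... | l , inf , inj₁ q = l , inf , inj₁ (SimplePath-unique q (SimplePath-map τ τ-inj τ-E (proj₁ (std-path k))))
    ... | l , inf , inj₂ q = l , inf , inj₂ (SimplePath-unique q (SimplePath-map τ τ-inj τ-E (proj₂ (std-path k))))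

    standard-edge : ∀ k {l i j} → Standard τ k l → Edge l (τ i) (τ j) ⇔ Edge (stdList k) i j
    standard-edge k (inj₁ refl) = mk⇔ (Edge-map⁻ τ τ-inj (stdList k)) (Edge-map⁺ τ)
    standard-edge k {i = i} {j} (inj₂ refl) =
      mk⇔ (proj₁ (std-reverse k i j) ∘ Edge-map⁻ τ τ-inj (reverse (stdList k)))
          (Edge-map⁺ τ ∘ proj₂ (std-reverse k i j))

    -- Reduces minimality to two vertices per path: a path that keeps both ends keeps everything
    -- between.
    standard-spans : ∀ k P → P ∋ τ (std-first k) → P ∋ τ (std-last k) →
                     ∀ {i j} → Edge (stdList k) i j → edge P (τ i) (τ j)
    standard-spans k P a∈ b∈ {i} {j} e with standard-segment k P a∈ b∈
    ... | l , (pre , post , eq) , std = Edge⇒EdgeIn (subst (λ l → Edge l (τ i) (τ j)) (sym eq)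
          (Edge-++⁺ʳ pre (Edge-++⁺ˡ (Equivalence.from (standard-edge k std) e))))

-- From a fold to the standard representation

StarTo : Rep 5 → (Rep 5 → Set) → Set
StarTo R Good = ∃ λ R′ → Star Minify R R′ × Good R′

module _ (lab : Fin 5 ↔ Fin 5) where

  open Inverse lab using () renaming (to to lab→; from to lab←; strictlyInverseˡ to lab-inv)

  FoldRep : Rep 5 → Set
  FoldRep R = Fold (Rep.T R) (Rep.P R ∘ lab→)

  -- Since fibres are connected, a fibre without a tree edge inside is a single vertex.
  Collapsed : Rep 5 → Set
  Collapsed R = Σ (FoldRep R) λ F → ∀ {p q} → AdjT R p q → Fold.f F p ≢ Fold.f F q

  module Step {m : ℕ} (T : Tree (suc m)) (P : Fin 5 → Path T) (F : Fold T (P ∘ lab→))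
              {x y : Fin (suc m)} (xy : Tree.E T x y) (fx≡fy : Fold.f F x ≡ Fold.f F y) where
    open Fold F
    open Tree T using (E)
    open Contraction T xy

    f-same : ∀ {a b} → π a ≡ π b → f a ≡ f b
    f-same eq with π-same eq
    ... | inj₁ refl                  = refl
    ... | inj₂ (inj₁ (refl , refl)) = fx≡fy
    ... | inj₂ (inj₂ (refl , refl)) = sym fx≡fy

    covers-≢ : ∀ k {i j p q} → Edge (stdList k) i j → f p ≡ i → f q ≡ j → π p ≢ π q
    covers-≢ k {i} e refl refl eq = std-irrefl k i (subst (Edge (stdList k) i) (sym (f-same eq)) e)

    -- The lift of a standard edge joins two different fibres, so the contraction inside a fibre
    -- leaves every path an edge.
    survives : ∀ k → ∃₂ λ a b → edge (P (lab→ k)) a b × π a ≢ π b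
    survives k with std-nonempty k
    ... | _ , _ , e with covers k e
    ...   | p , q , fp , fq , e′ = p , q , e′ , covers-≢ k e fp fq

    survive : ∀ v → ∃₂ λ a b → edge (P v) a b × π a ≢ π b
    survive v = subst (λ w → ∃₂ λ a b → edge (P w) a b × π a ≢ π b) (lab-inv v) (survives (lab← v))

    R′ : Rep 5
    R′ = record { m = m ; T = T′ ; P = P′ P survive }

    f′ : Fin m → Fin 7
    f′ s = f (ι s)

    f′-π : ∀ t → f′ (π t) ≡ f t
    f′-π t = f-same (π-ι (π t))

    fibre′ : ∀ {p q} → Star (λ a b → E a b × f a ≡ f b) p q →
             Star (λ a b → Adj graph′ a b × f′ a ≡ f′ b) (π p) (π q)
    fibre′ ε = ε
    fibre′ {p} {q} (_◅_ {j = t} (e , eq) s) with π p ≟ π t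
    ... | yes same = subst (λ a → Star _ a (π q)) (sym same) (fibre′ s)
    ... | no ne    = (from-E′ (p , t , refl , refl , e , ne) , trans (f′-π p) (trans eq (sym (f′-π t)))) ◅ fibre′ s

    F′ : FoldRep R′
    F′ = record { f = f′ ; hom = hom′ ; fibres = fibres′ ; covers = covers′ }
      where
      hom′ : ∀ {p q} → Adj graph′ p q → f′ p ≡ f′ q ⊎ stdTree (f′ p) (f′ q) ≡ true
      hom′ e with to-E′ e
      ... | a , b , refl , refl , e′ , _ rewrite f′-π a | f′-π b = hom e′
      fibres′ : ∀ p q → f′ p ≡ f′ q → Star (λ a b → Adj graph′ a b × f′ a ≡ f′ b) p q
      fibres′ p q eq = subst₂ (Star _) (π-ι p) (π-ι q) (fibre′ (fibres (ι p) (ι q) eq))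
      covers′ : ∀ k {i j} → Edge (stdList k) i j →
                ∃₂ λ p q → f′ p ≡ i × f′ q ≡ j × edge (Rep.P R′ (lab→ k)) p q
      covers′ k e with covers k e
      ... | p , q , fp , fq , e′ = π p , π q , trans (f′-π p) fp , trans (f′-π q) fq ,
        Equivalence.from (contract-edge (P (lab→ k)) (survive (lab→ k)) (π p) (π q))
          (p , q , refl , refl , e′ , covers-≢ k e fp fq)

    shorter : Minify (record { m = suc m ; T = T ; P = P }) R′
    shorter = inj₁ (contract P survive)

  abstract

    collapse : ∀ m (T : Tree m) (P : Fin 5 → Path T) → Fold T (P ∘ lab→) →
               StarTo (record { m = m ; T = T ; P = P }) Collapsed
    collapse m T P F with any? (λ p → any? λ q →
      (SimpleGraph.adj (Tree.graph T) p q Bool.≟ true) ×-dec (Fold.f F p ≟ Fold.f F q))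
    ... | no none = _ , ε , F , λ {p} {q} e eq → none (p , q , e , eq)
    collapse (suc m) T P F | yes (x , y , xy , eq) =
      let open Step T P F xy eq
          (R″ , s , good) = collapse m (Rep.T R′) (Rep.P R′) F′
      in R″ , shorter ◅ s , good

  fold-onto : ∀ R (F : FoldRep R) → ∀ i → ∃ λ p → Fold.f F p ≡ i
  fold-onto R F i with std-occurs i
  ... | k , j , e with Fold.covers F k e
  ...   | p , _ , fp , _ = p , fp

  fold-size : ∀ R → FoldRep R → 7 ≤ Rep.m R
  fold-size R F = injective⇒≤ {f = λ i → proj₁ (fold-onto R F i)}
    λ {i} {j} eq → trans (sym (proj₂ (fold-onto R F i))) (trans (cong (Fold.f F) eq) (proj₂ (fold-onto R F j)))

  module Final {m : ℕ} (T : Tree m) (P : Fin 5 → Path T) (F : Fold T (P ∘ lab→))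
               (separated : ∀ {p q} → Tree.E T p q → Fold.f F p ≢ Fold.f F q) where
    open Fold F
    open Tree T using (E)
    open TreeTheory T
    open PathTheory T
    open Trim {5} T
    open Path using (verts)

    f-inj : ∀ {p q} → f p ≡ f q → p ≡ q
    f-inj {p} {q} eq with fibres p q eq
    ... | ε            = refl
    ... | (e , eq′) ◅ _ = contradiction eq′ (separated e)

    τ→ : Fin 7 → Fin m
    τ→ i = proj₁ (fold-onto (rep P) F i)

    f-τ : ∀ i → f (τ→ i) ≡ i
    f-τ i = proj₂ (fold-onto (rep P) F i)

    τ-f : ∀ p → τ→ (f p) ≡ p
    τ-f p = f-inj (f-τ (f p))

    τ : Fin 7 ↔ Fin m
    τ = mk↔ₛ′ τ→ f τ-f f-τ

    τ-inj : ∀ {i j} → τ→ i ≡ τ→ j → i ≡ j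
    τ-inj {i} {j} eq = trans (sym (f-τ i)) (trans (cong f eq) (f-τ j))

    lifted : ∀ k {i j} → Edge (stdList k) i j → edge (P (lab→ k)) (τ→ i) (τ→ j)
    lifted k e with covers k e
    ... | p , q , refl , refl , e′ = subst₂ (edge (P (lab→ k))) (sym (τ-f p)) (sym (τ-f q)) e′

    τ-E : ∀ {i j} → stdTree i j ≡ true → E (τ→ i) (τ→ j)
    τ-E {i} {j} e with std-tree-edge i j e
    ... | k , e′ = edge⇒E (P (lab→ k)) (lifted k e′)

    E-τ : ∀ {i j} → E (τ→ i) (τ→ j) → stdTree i j ≡ true
    E-τ {i} {j} e with hom e
    ... | inj₁ eq  = contradiction eq (separated e)
    ... | inj₂ std = subst₂ StdEdge (f-τ i) (f-τ j) std

    bool-≡ : ∀ {a b : Bool} → (a ≡ true → b ≡ true) → (b ≡ true → a ≡ true) → a ≡ b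
    bool-≡ {true}  {b}     f _ = sym (f refl)
    bool-≡ {false} {true}  _ g = g refl
    bool-≡ {false} {false} _ _ = refl

    on-path : ∀ k {i} → i ∈ stdList k → P (lab→ k) ∋ τ→ i
    on-path k {i} i∈ = edge⇒∋ (P (lab→ k)) (lifted k (proj₂ (std-on-path k i i∈)))

    abstract

      target : ∀ k → ∃ λ l → Infix l (verts (P (lab→ k))) × Standard τ→ k l
      target k = standard-segment τ-inj τ-E k (P (lab→ k))
        (on-path k (start-∈ (proj₁ (std-path k)))) (on-path k (end-∈ (proj₁ (std-path k))))

    goal : Fin 5 → List (Fin m)
    goal v = proj₁ (target (lab← v))

    goal-infix : ∀ v → Infix (goal v) (verts (P v))
    goal-infix v = subst (λ w → Infix (goal v) (verts (P w))) (lab-inv v) (proj₁ (proj₂ (target (lab← v))))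

    goal-long : ∀ v → 2 ≤ length (goal v)
    goal-long v with std-nonempty (lab← v)
    ... | i , j , e = Edge-long (Equivalence.from (standard-edge τ-inj τ-E (lab← v) (proj₂ (proj₂ (target (lab← v))))) e)

    goal-edge : ∀ k {i j} → Edge (goal (lab→ k)) (τ→ i) (τ→ j) ⇔ Edge (stdList k) i j
    goal-edge k {i} {j} =
      subst (λ k′ → Edge (goal (lab→ k)) (τ→ i) (τ→ j) ⇔ Edge (stdList k′) i j) (Inverse.strictlyInverseʳ lab k)
        (standard-edge τ-inj τ-E (lab← (lab→ k)) (proj₂ (proj₂ (target (lab← (lab→ k))))))

    goal⇒standard : ∀ P′ → (∀ v → verts (P′ v) ≡ goal v) → IsStd lab (rep P′)
    goal⇒standard P′ done = τ , (λ i j → bool-≡ (E-τ {i} {j}) τ-E) , λ k i j → mk⇔ (to k) (from k)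
      where
      to : ∀ k {i j} → edge (P′ (lab→ k)) (τ→ i) (τ→ j) → EdgeIn (stdPath k) (toℕ i) (toℕ j)
      to k {i} {j} e = Equivalence.from (EdgeIn-std k) (Equivalence.to (goal-edge k)
        (EdgeIn⇒Edge (subst (λ l → EdgeIn l (τ→ i) (τ→ j)) (done (lab→ k)) e)))
      from : ∀ k {i j} → EdgeIn (stdPath k) (toℕ i) (toℕ j) → edge (P′ (lab→ k)) (τ→ i) (τ→ j)
      from k {i} {j} e = subst (λ l → EdgeIn l (τ→ i) (τ→ j)) (sym (done (lab→ k)))
        (Edge⇒EdgeIn (Equivalence.from (goal-edge k) (Equivalence.to (EdgeIn-std k) e)))

    standard : StarTo (rep P) (IsStd lab)
    standard =
      let (P′ , s , done) = trim-all goal goal-long P goal-infix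
      in rep P′ , s , goal⇒standard P′ done

  fold⇒standard : ∀ R → FoldRep R → StarTo R (IsStd lab)
  fold⇒standard R F =
    let (R₁ , s₁ , F₁ , separated) = collapse (Rep.m R) (Rep.T R) (Rep.P R) F
        (R₂ , s₂ , std) = Final.standard (Rep.T R₁) (Rep.P R₁) F₁ separated
    in R₂ , s₁ ◅◅ s₂ , std

-- Intersections and splits of the standard paths

Incident : Fin 5 → Fin 5 → Fin 7 → Fin 7 → Set
Incident k l i a = Edge (stdList k) i a ⊎ Edge (stdList l) i a

StdMeet : Fin 5 → Fin 5 → Set
StdMeet k l = ∃ λ i → ∃ λ j → Edge (stdList k) i j × Edge (stdList l) i j

-- Each condition stands right after the vertex it restricts, so that the exhaustive search abandons
-- a failing choice before trying the next vertex.
StdSplit : Fin 5 → Fin 5 → Fin 7 → Set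
StdSplit k l i = ∃ λ a → Incident k l i a × ∃ λ b → (a ≢ b × Incident k l i b) ×
                 ∃ λ c → a ≢ c × b ≢ c × Incident k l i c

private
  std? : ∀ k i j → Dec (Edge (stdList k) i j)
  std? k = Edge? _≟_ (stdList k)

  incident? : ∀ k l i a → Dec (Incident k l i a)
  incident? k l i a = std? k i a ⊎-dec std? l i a

  meet? : ∀ k l → Dec (StdMeet k l)
  meet? k l = any? λ i → any? λ j → std? k i j ×-dec std? l i j

  split? : ∀ k l i → Dec (StdSplit k l i)
  split? k l i = any? λ a → incident? k l i a ×-dec any? λ b → (¬? (a ≟ b) ×-dec incident? k l i b) ×-dec
                 any? λ c → ¬? (a ≟ c) ×-dec ¬? (b ≟ c) ×-dec incident? k l i c

-- At every split of paths k and l, path k leaves towards y.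
Forces : Fin 5 → Fin 5 → Fin 7 → Set
Forces k l y = (∀ i → ¬ Edge (stdList l) i y) ×
  (∀ i a → Incident k l i a → ∀ b → a ≢ b → Incident k l i b →
     ∀ c → a ≢ c → b ≢ c → Incident k l i c → y ≡ a ⊎ y ≡ b ⊎ y ≡ c)

-- Whichever common edge survives trimming, path `k` then still contains `y`.
OnlyMeet : Fin 5 → Fin 5 → Fin 7 → Set
OnlyMeet k l y = ∀ i j → Edge (stdList k) i j → Edge (stdList l) i j → y ≡ i ⊎ y ≡ j

private
  forces? : ∀ k l y → Dec (Forces k l y)
  forces? k l y = (all? λ i → ¬? (std? l i y)) ×-dec
    (all? λ i → all? λ a → incident? k l i a →-dec (all? λ b → ¬? (a ≟ b) →-dec (incident? k l i b →-dec
      (all? λ c → ¬? (a ≟ c) →-dec (¬? (b ≟ c) →-dec (incident? k l i c →-dec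
        (y ≟ a ⊎-dec (y ≟ b ⊎-dec y ≟ c))))))))

  onlyMeet? : ∀ k l y → Dec (OnlyMeet k l y)
  onlyMeet? k l y = all? λ i → all? λ j → std? k i j →-dec (std? l i j →-dec (y ≟ i ⊎-dec y ≟ j))

abstract

  std-meet : ∀ k l → k ≢ l → (stdG k l ≡ true → StdMeet k l) × (StdMeet k l → stdG k l ≡ true)
  std-meet = from-yes (all? λ k → all? λ l → ¬? (k ≟ l) →-dec
    (((stdG k l Bool.≟ true) →-dec meet? k l) ×-dec (meet? k l →-dec (stdG k l Bool.≟ true))))

  std-∼ : ∀ k l → k ≢ l → (stdC k l ≡ true → StdMeet k l × (∀ i → ¬ StdSplit k l i)) ×
                          (StdMeet k l × (∀ i → ¬ StdSplit k l i) → stdC k l ≡ true)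
  std-∼ = from-yes (all? λ k → all? λ l → ¬? (k ≟ l) →-dec
    (((stdC k l Bool.≟ true) →-dec line? k l) ×-dec (line? k l →-dec (stdC k l Bool.≟ true))))
    where
    line? : ∀ k l → Dec (StdMeet k l × (∀ i → ¬ StdSplit k l i))
    line? k l = meet? k l ×-dec all? λ i → ¬? (split? k l i)

  forces-020 : Forces 0F 2F 0F
  forces-020 = from-yes (forces? 0F 2F 0F)
  forces-201 : Forces 2F 0F 1F
  forces-201 = from-yes (forces? 2F 0F 1F)
  forces-301 : Forces 3F 0F 1F
  forces-301 = from-yes (forces? 3F 0F 1F)
  forces-135 : Forces 1F 3F 5F
  forces-135 = from-yes (forces? 1F 3F 5F)
  forces-316 : Forces 3F 1F 6F
  forces-316 = from-yes (forces? 3F 1F 6F)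
  forces-416 : Forces 4F 1F 6F
  forces-416 = from-yes (forces? 4F 1F 6F)
  meet-044 : OnlyMeet 0F 4F 4F
  meet-044 = from-yes (onlyMeet? 0F 4F 4F)
  meet-122 : OnlyMeet 1F 2F 2F
  meet-122 = from-yes (onlyMeet? 1F 2F 2F)
  meet-213 : OnlyMeet 2F 1F 3F
  meet-213 = from-yes (onlyMeet? 2F 1F 3F)
  meet-403 : OnlyMeet 4F 0F 3F
  meet-403 = from-yes (onlyMeet? 4F 0F 3F)

-- Sequences of minifying operations

record SubRep {n : ℕ} (R R′ : Rep n) : Set where
  field
    σ   : Fin (Rep.m R) ↔ Fin (Rep.m R′)
    adj : ∀ a b → adjT R′ (Inverse.to σ a) (Inverse.to σ b) ≡ adjT R a b
    sub : ∀ v a b → edgeR R′ v (Inverse.to σ a) (Inverse.to σ b) → edgeR R v a b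

↔-injective : ∀ {A B : Set} (σ : A ↔ B) {a b} → Inverse.to σ a ≡ Inverse.to σ b → a ≡ b
↔-injective σ {a} {b} eq = trans (sym (Inverse.strictlyInverseʳ σ a))
  (trans (cong (Inverse.from σ) eq) (Inverse.strictlyInverseʳ σ b))

↔⇒≤ : ∀ {m n} → Fin m ↔ Fin n → m ≤ n
↔⇒≤ σ = injective⇒≤ {f = Inverse.to σ} (↔-injective σ)

-- A section of `f` misses `x` or `y`, and the missed vertex extends it to an injection from one
-- more element.
contract-size : ∀ {n} {R R′ : Rep n} → Contract R R′ → Rep.m R′ < Rep.m R
contract-size {R = R} {R′} (x , y , xy , f , onto , glue , _) = injective⇒≤ {f = h} h-inj
  where
  x≢y : x ≢ y
  x≢y = TreeTheory.E⇒≢ (Rep.T R) xy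
  fx≡fy : f x ≡ f y
  fx≡fy = Equivalence.from (glue x y) (inj₂ (inj₁ (refl , refl)))
  s : Fin (Rep.m R′) → Fin (Rep.m R)
  s b = proj₁ (onto b)
  f-s : ∀ b → f (s b) ≡ b
  f-s b = proj₂ (onto b)
  other : ∃ λ z → ∀ b → s b ≢ z
  other with s (f x) ≟ x
  ... | yes eq = y , λ b sb → x≢y (trans (sym eq) (trans (cong s (trans fx≡fy (trans (cong f (sym sb)) (f-s b)))) sb))
  ... | no ne  = x , λ b sb → ne (trans (cong s (trans (cong f (sym sb)) (f-s b))) sb)
  h : Fin (suc (Rep.m R′)) → Fin (Rep.m R)
  h zero    = proj₁ other
  h (suc b) = s b
  h-inj : ∀ {a b} → h a ≡ h b → a ≡ b
  h-inj {zero}  {zero}  _  = refl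
  h-inj {zero}  {suc b} eq = contradiction (sym eq) (proj₂ other b)
  h-inj {suc a} {zero}  eq = contradiction eq (proj₂ other a)
  h-inj {suc a} {suc b} eq = cong suc (trans (sym (f-s a)) (trans (cong f eq) (f-s b)))

-- No operation restores a vertex lost by a contraction; without contractions the tree stays and the
-- paths only lose edges.
minified : ∀ {n} {R R′ : Rep n} → Star Minify R R′ → Rep.m R′ < Rep.m R ⊎ SubRep R R′
minified ε = inj₂ (record { σ = ↔-id _ ; adj = λ _ _ → refl ; sub = λ _ _ _ e → e })
minified {R = R} {R′} (_◅_ {j = R₁} (inj₁ con) s) = inj₁ (rest (minified s))
  where
  rest : Rep.m R′ < Rep.m R₁ ⊎ SubRep R₁ R′ → Rep.m R′ < Rep.m R
  rest (inj₁ less) = ℕ.<-trans less (contract-size {R = R} {R₁} con)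
  rest (inj₂ S)    = ℕ.≤-<-trans (↔⇒≤ (↔-sym (SubRep.σ S))) (contract-size {R = R} {R₁} con)
minified {R = R} {R′} (_◅_ {j = R₁} (inj₂ (σ , adj , v , x , y , _ , edges)) s) = rest (minified s)
  where
  rest : Rep.m R′ < Rep.m R₁ ⊎ SubRep R₁ R′ → Rep.m R′ < Rep.m R ⊎ SubRep R R′
  rest (inj₁ less) = inj₁ (ℕ.<-≤-trans less (↔⇒≤ (↔-sym σ)))
  rest (inj₂ S)    = inj₂ record
    { σ   = SubRep.σ S ↔-∘ σ
    ; adj = λ a b → trans (SubRep.adj S _ _) (adj a b)
    ; sub = λ w a b e → proj₁ (Equivalence.to (edges w a b) (SubRep.sub S w _ _ e))
    }

IsStd-Iso : ∀ {lab R R′} → Iso R R′ → IsStd lab R′ → IsStd lab R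
IsStd-Iso {lab} {R} {R′} (σ , adj , edges) (τ , adjτ , edgesτ) =
  ↔-sym σ ↔-∘ τ ,
  (λ i j → trans (sym (adj _ _)) (trans (cong₂ (adjT R′) (inv i) (inv j)) (adjτ i j))) ,
  λ k i j → mk⇔
    (λ e → Equivalence.to (edgesτ k i j) (subst₂ (edgeR R′ (Inverse.to lab k)) (inv i) (inv j)
             (Equivalence.from (edges (Inverse.to lab k) _ _) e)))
    (λ e → Equivalence.to (edges (Inverse.to lab k) _ _) (subst₂ (edgeR R′ (Inverse.to lab k))
             (sym (inv i)) (sym (inv j)) (Equivalence.from (edgesτ k i j) e)))
  where
  inv : ∀ i → Inverse.to σ (Inverse.from σ (Inverse.to τ i)) ≡ Inverse.to τ i
  inv i = Inverse.strictlyInverseˡ σ (Inverse.to τ i)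

-- Representations of the labelled pair

module Labelled (G C : SimpleGraph 5) (lab : Fin 5 ↔ Fin 5)
  (C-std : ∀ i j → SimpleGraph.adj C (Inverse.to lab i) (Inverse.to lab j) ≡ stdC i j) where

  open Inverse lab using () renaming (to to lab→; from to lab←; strictlyInverseˡ to lab-inv)

  lab-≢ : ∀ {k l} → k ≢ l → lab→ k ≢ lab→ l
  lab-≢ k≢l eq = k≢l (↔-injective lab eq)

  module _ (R : Rep 5) where

    Q : Fin 5 → Path (Rep.T R)
    Q k = Rep.P R (lab→ k)

  module _ (R : Rep 5) (rep : Represents G C R) where

    adjacent⇒meet : ∀ k l → k ≢ l → Adj G (lab→ k) (lab→ l) → Intersect (Q R k) (Q R l)
    adjacent⇒meet k l k≢l = Equivalence.to (proj₁ (rep _ _ (lab-≢ k≢l)))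

    meet⇒adjacent : ∀ k l → k ≢ l → Intersect (Q R k) (Q R l) → Adj G (lab→ k) (lab→ l)
    meet⇒adjacent k l k≢l = Equivalence.from (proj₁ (rep _ _ (lab-≢ k≢l)))

    cyclic⇒∼ : ∀ k l → k ≢ l → stdC k l ≡ true → Q R k ∼ Q R l
    cyclic⇒∼ k l k≢l c = Equivalence.to (proj₂ (rep _ _ (lab-≢ k≢l))) (trans (C-std k l) c)

    chord⇒≁ : ∀ k l → k ≢ l → stdC k l ≡ false → ¬ (Q R k ∼ Q R l)
    chord⇒≁ k l k≢l c k∼l
      with trans (sym c) (trans (sym (C-std k l)) (Equivalence.from (proj₂ (rep _ _ (lab-≢ k≢l))) k∼l))
    ... | ()

    open Structure (Rep.T R)

    pentagon : Adj G (lab→ 0F) (lab→ 2F) → Adj G (lab→ 0F) (lab→ 3F) → Adj G (lab→ 1F) (lab→ 3F) → Pentagon (Q R)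
    pentagon a02 a03 a13 = record
      { ∼01 = cyclic⇒∼ 0F 1F (λ ()) refl ; ∼12 = cyclic⇒∼ 1F 2F (λ ()) refl
      ; ∼23 = cyclic⇒∼ 2F 3F (λ ()) refl ; ∼34 = cyclic⇒∼ 3F 4F (λ ()) refl
      ; ∼40 = cyclic⇒∼ 4F 0F (λ ()) refl
      ; meet02 = adjacent⇒meet 0F 2F (λ ()) a02 ; meet03 = adjacent⇒meet 0F 3F (λ ()) a03
      ; meet13 = adjacent⇒meet 1F 3F (λ ()) a13
      ; ≁02 = chord⇒≁ 0F 2F (λ ()) refl ; ≁03 = chord⇒≁ 0F 3F (λ ()) refl ; ≁13 = chord⇒≁ 1F 3F (λ ()) refl
      ; ≁14 = chord⇒≁ 1F 4F (λ ()) refl ; ≁24 = chord⇒≁ 2F 4F (λ ()) refl }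

  module Standard (G-std : ∀ i j → SimpleGraph.adj G (lab→ i) (lab→ j) ≡ stdG i j) where

    represents⇒fold : ∀ R → Represents G C R → FoldRep lab R
    represents⇒fold R rep = pick (pentagon⇒skeleton (pentagon R rep (G-std 0F 2F) (G-std 0F 3F) (G-std 1F 3F)))
      where
      open Structure (Rep.T R)
      pick : Skeleton (Q R) ⊎ Skeleton (Q R ∘ mirror) → FoldRep lab R
      pick (inj₁ sk) = skeleton⇒fold sk
      -- In the reflected skeleton it is the paths 1 and 4 that are disjoint, but 14 is an edge of
      -- `stdG`.
      pick (inj₂ sk) = contradiction (adjacent⇒meet R rep 1F 4F (λ ()) (G-std 1F 4F)) (Skeleton.apart24 sk)

    module _ (R : Rep 5) (std : IsStd lab R) where

      private
        τ = proj₁ std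
        open Inverse τ using () renaming (to to τ→; from to τ←; strictlyInverseˡ to τ-inv)

      std-edge : ∀ k {i j} → edgeR R (lab→ k) (τ→ i) (τ→ j) ⇔ Edge (stdList k) i j
      std-edge k {i} {j} = mk⇔
        (Equivalence.to (EdgeIn-std k) ∘ Equivalence.to (proj₂ (proj₂ std) k i j))
        (Equivalence.from (proj₂ (proj₂ std) k i j) ∘ Equivalence.from (EdgeIn-std k))

      private
        pull : ∀ k {p q} → edgeR R (lab→ k) p q → Edge (stdList k) (τ← p) (τ← q)
        pull k {p} {q} e = Equivalence.to (std-edge k)
          (subst₂ (edgeR R (lab→ k)) (sym (τ-inv p)) (sym (τ-inv q)) e)

        pullᵢ : ∀ k l {p q} → edgeR R (lab→ k) p q ⊎ edgeR R (lab→ l) p q → Incident k l (τ← p) (τ← q)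
        pullᵢ k l = Sum.map (pull k) (pull l)

        push : ∀ k {i j} → Edge (stdList k) i j → edgeR R (lab→ k) (τ→ i) (τ→ j)
        push k = Equivalence.from (std-edge k)

        τ←-≢ : ∀ {p q} → p ≢ q → τ← p ≢ τ← q
        τ←-≢ p≢q eq = p≢q (trans (sym (τ-inv _)) (trans (cong τ→ eq) (τ-inv _)))

        τ→-≢ : ∀ {i j} → i ≢ j → τ→ i ≢ τ→ j
        τ→-≢ i≢j eq = i≢j (↔-injective τ eq)

        P : Fin 5 → Path (Rep.T R)
        P k = Rep.P R (lab→ k)

        meet⇔ : ∀ k l → Intersect (P k) (P l) ⇔ StdMeet k l
        meet⇔ k l = mk⇔ (λ (p , q , e , e′) → τ← p , τ← q , pull k e , pull l e′)
                        (λ (i , j , e , e′) → τ→ i , τ→ j , push k e , push l e′)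

        split⇒std : ∀ k l {p} → InSplit (P k) (P l) p → StdSplit k l (τ← p)
        split⇒std k l (a , b , c , ab , ac , bc , ea , eb , ec) =
          τ← a , pullᵢ k l ea , τ← b , (τ←-≢ ab , pullᵢ k l eb) , τ← c , τ←-≢ ac , τ←-≢ bc , pullᵢ k l ec

        std⇒split : ∀ k l {i} → StdSplit k l i → InSplit (P k) (P l) (τ→ i)
        std⇒split k l (a , ea , b , (ab , eb) , c , ac , bc , ec) =
          τ→ a , τ→ b , τ→ c , τ→-≢ ab , τ→-≢ ac , τ→-≢ bc ,
          Sum.map (push k) (push l) ea , Sum.map (push k) (push l) eb , Sum.map (push k) (push l) ec

        ∼⇔ : ∀ k l → (P k ∼ P l) ⇔ (StdMeet k l × (∀ i → ¬ StdSplit k l i))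
        ∼⇔ k l = mk⇔
          (λ (meet , ns) → Equivalence.to (meet⇔ k l) meet , λ i s → ns (τ→ i) (std⇒split k l s))
          (λ (meet , ns) → Equivalence.from (meet⇔ k l) meet , λ p s → ns (τ← p) (split⇒std k l s))

        represents-at : ∀ k l → k ≢ l →
          (Adj G (lab→ k) (lab→ l) ⇔ Intersect (P k) (P l)) × (Adj C (lab→ k) (lab→ l) ⇔ (P k ∼ P l))
        represents-at k l k≢l =
          mk⇔ (λ a → Equivalence.from (meet⇔ k l) (proj₁ (std-meet k l k≢l) (trans (sym (G-std k l)) a)))
              (λ i → trans (G-std k l) (proj₂ (std-meet k l k≢l) (Equivalence.to (meet⇔ k l) i))) ,
          mk⇔ (λ a → Equivalence.from (∼⇔ k l) (proj₁ (std-∼ k l k≢l) (trans (sym (C-std k l)) a)))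
              (λ s → trans (C-std k l) (proj₂ (std-∼ k l k≢l) (Equivalence.to (∼⇔ k l) s)))

      standard⇒represents : Represents G C R
      standard⇒represents u v u≢v =
        subst₂ (λ u v → (Adj G u v ⇔ Intersect (Rep.P R u) (Rep.P R v)) × (Adj C u v ⇔ (Rep.P R u ∼ Rep.P R v)))
          (lab-inv u) (lab-inv v)
          (represents-at (lab← u) (lab← v)
            λ eq → u≢v (trans (sym (lab-inv u)) (trans (cong lab→ eq) (lab-inv v))))

      module Sub (R′ : Rep 5) (S : SubRep R R′) (rep : Represents G C R′) where
        open SubRep S
        open PathTheory (Rep.T R′)
        open Trim {5} (Rep.T R′) using (standard-spans)

        ρ : Fin 7 ↔ Fin (Rep.m R′)
        ρ = σ ↔-∘ τ
        open Inverse ρ using () renaming (to to ρ→; from to ρ←; strictlyInverseˡ to ρ-inv)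

        P′ : Fin 5 → Path (Rep.T R′)
        P′ k = Rep.P R′ (lab→ k)

        sub-std : ∀ k {p q} → edge (P′ k) p q → Edge (stdList k) (ρ← p) (ρ← q)
        sub-std k {p} {q} e = Equivalence.to (std-edge k) (sub (lab→ k) _ _
          (subst₂ (edge (P′ k)) (sym (ρ-inv p)) (sym (ρ-inv q)) e))

        ρ←-≢ : ∀ {p q} → p ≢ q → ρ← p ≢ ρ← q
        ρ←-≢ p≢q eq = p≢q (trans (sym (ρ-inv _)) (trans (cong ρ→ eq) (ρ-inv _)))

        at : ∀ k {p y} → y ≡ ρ← p → P′ k ∋ p → P′ k ∋ ρ→ y
        at k {p} y≡ = subst (P′ k ∋_) (trans (sym (ρ-inv p)) (cong ρ→ (sym y≡)))

        by-meet : ∀ k l {y} → k ≢ l → stdC k l ≡ true → OnlyMeet k l y → P′ k ∋ ρ→ y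
        by-meet k l k≢l c only with proj₁ (cyclic⇒∼ R′ rep k l k≢l c)
        ... | p , q , e , e′ with only _ _ (sub-std k e) (sub-std l e′)
        ...   | inj₁ eq = at k eq (edge⇒∋ (P′ k) e)
        ...   | inj₂ eq = at k eq (edge⇒∋ʳ (P′ k) e)

        -- The two paths must still split somewhere. Every possible split uses an edge to `y`, path
        -- `l` has none, so path `k` has kept one.
        by-split : ∀ k l {y} → k ≢ l → stdG k l ≡ true → stdC k l ≡ false → Forces k l y → P′ k ∋ ρ→ y
        by-split k l {y} k≢l g c (off , force)
          with intersecting⇒split {P′ k} {P′ l} (adjacent⇒meet R′ rep k l k≢l (trans (G-std k l) g)) (chord⇒≁ R′ rep k l k≢l c)
        ... | x , a₁ , a₂ , a₃ , n₁₂ , n₁₃ , n₂₃ , e₁ , e₂ , e₃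
          with force _ _ (inc e₁) _ (ρ←-≢ n₁₂) (inc e₂) _ (ρ←-≢ n₁₃) (ρ←-≢ n₂₃) (inc e₃)
          where
          inc : ∀ {p q} → edge (P′ k) p q ⊎ edge (P′ l) p q → Incident k l (ρ← p) (ρ← q)
          inc = Sum.map (sub-std k) (sub-std l)
        ...   | hit = pick hit
          where
          use : ∀ {a} → y ≡ ρ← a → edge (P′ k) x a ⊎ edge (P′ l) x a → P′ k ∋ ρ→ y
          use eq (inj₁ e) = at k eq (edge⇒∋ʳ (P′ k) e)
          use eq (inj₂ e) = contradiction (subst (Edge (stdList l) _) (sym eq) (sub-std l e)) (off _)
          pick : y ≡ ρ← a₁ ⊎ y ≡ ρ← a₂ ⊎ y ≡ ρ← a₃ → P′ k ∋ ρ→ y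
          pick (inj₁ eq)        = use eq e₁
          pick (inj₂ (inj₁ eq)) = use eq e₂
          pick (inj₂ (inj₂ eq)) = use eq e₃

        -- An end at a leaf of the standard tree is kept by the split with a chord partner, an end
        -- at an inner vertex by the only edge shared with a cycle neighbour.
        first∈ : ∀ k → P′ k ∋ ρ→ (std-first k)
        first∈ 0F = by-split 0F 2F (λ ()) refl refl forces-020
        first∈ 1F = by-meet 1F 2F (λ ()) refl meet-122
        first∈ 2F = by-split 2F 0F (λ ()) refl refl forces-201
        first∈ 3F = by-split 3F 0F (λ ()) refl refl forces-301
        first∈ 4F = by-meet 4F 0F (λ ()) refl meet-403

        last∈ : ∀ k → P′ k ∋ ρ→ (std-last k)
        last∈ 0F = by-meet 0F 4F (λ ()) refl meet-044
        last∈ 1F = by-split 1F 3F (λ ()) refl refl forces-135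
        last∈ 2F = by-meet 2F 1F (λ ()) refl meet-213
        last∈ 3F = by-split 3F 1F (λ ()) refl refl forces-316
        last∈ 4F = by-split 4F 1F (λ ()) refl refl forces-416

        ρ-E : ∀ {i j} → StdEdge i j → AdjT R′ (ρ→ i) (ρ→ j)
        ρ-E {i} {j} e = trans (adj _ _) (trans (proj₁ (proj₂ std) i j) e)

        full : ∀ k {a b} → edgeR R (lab→ k) a b → edgeR R′ (lab→ k) (Inverse.to σ a) (Inverse.to σ b)
        full k {a} {b} e = subst₂ (edge (P′ k)) (cong (Inverse.to σ) (τ-inv a)) (cong (Inverse.to σ) (τ-inv b))
          (standard-spans (λ {i} {j} → ↔-injective ρ {i} {j}) ρ-E k (P′ k) (first∈ k) (last∈ k) (pull k e))

        iso : Iso R R′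
        iso = σ , adj , λ v a b → mk⇔ (sub v a b) λ e →
          subst (λ v → edgeR R′ v (Inverse.to σ a) (Inverse.to σ b)) (lab-inv v)
            (full (lab← v) (subst (λ v → edgeR R v a b) (sym (lab-inv v)) e))

      standard⇒minimal : Minimal G C R
      standard⇒minimal R′ s rep = [ (λ less → contradiction (ℕ.<-≤-trans less small) (ℕ.<-irrefl refl))
                                  , (λ S → Sub.iso R′ S rep) ]′ (minified s)
        where
        small : Rep.m R ≤ Rep.m R′
        small = ℕ.≤-trans (↔⇒≤ (↔-sym τ)) (fold-size lab R′ (represents⇒fold R′ rep))

    reduce : ∀ R → Represents G C R → StarTo R (IsStd lab)
    reduce R rep = fold⇒standard lab R (represents⇒fold R rep)

    existence : ∀ R → Represents G C R → ∃ λ R → Represents G C R × Minimal G C R × IsStd lab R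
    existence R rep = let (R′ , _ , std) = reduce R rep in
      R′ , standard⇒represents R′ std , standard⇒minimal R′ std , std

    uniqueness : ∀ R → Represents G C R → Minimal G C R → IsStd lab R
    uniqueness R rep minimal = let (R′ , s , std) = reduce R rep in
      IsStd-Iso {lab} {R} {R′} (minimal R′ s (standard⇒represents R′ std)) std

-- Labellings of the cycle

rotate : ℕ → Fin 5 → Fin 5
rotate zero    k = k
rotate (suc n) k = next (rotate n k)
  where
  next : Fin 5 → Fin 5
  next 0F = 1F
  next 1F = 2F
  next 2F = 3F
  next 3F = 4F
  next 4F = 0F

dihedral : Fin 2 → Fin 5 → Fin 5 → Fin 5
dihedral 0F r k = rotate (toℕ r) k
dihedral 1F r k = rotate (toℕ r) (mirror k)

abstract

  dihedral-onto : ∀ s r k → ∃ λ k′ → dihedral s r k′ ≡ k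
  dihedral-onto = from-yes (all? λ s → all? λ r → all? λ k → any? λ k′ → dihedral s r k′ ≟ k)

  dihedral-injective : ∀ s r k k′ → dihedral s r k ≡ dihedral s r k′ → k ≡ k′
  dihedral-injective = from-yes (all? λ s → all? λ r → all? λ k → all? λ k′ →
    (dihedral s r k ≟ dihedral s r k′) →-dec (k ≟ k′))

  dihedral-cycle : ∀ s r i j → stdC (dihedral s r i) (dihedral s r j) ≡ stdC i j
  dihedral-cycle = from-yes (all? λ s → all? λ r → all? λ i → all? λ j →
    stdC (dihedral s r i) (dihedral s r j) Bool.≟ stdC i j)

  -- The pentagon has ten directed paths on four vertices and ten symmetries, which permute them
  -- transitively.
  dihedral-path : ∀ i j k l → stdC i j ≡ true → stdC j k ≡ true → stdC k l ≡ true → i ≢ k → j ≢ l →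
    ∃₂ λ s r → dihedral s r 0F ≡ i × dihedral s r 1F ≡ j × dihedral s r 2F ≡ k × dihedral s r 3F ≡ l
  dihedral-path = from-yes (all? λ i → all? λ j → all? λ k → all? λ l →
    (stdC i j Bool.≟ true) →-dec ((stdC j k Bool.≟ true) →-dec ((stdC k l Bool.≟ true) →-dec
    (¬? (i ≟ k) →-dec (¬? (j ≟ l) →-dec (any? λ s → any? λ r →
      dihedral s r 0F ≟ i ×-dec dihedral s r 1F ≟ j ×-dec dihedral s r 2F ≟ k ×-dec dihedral s r 3F ≟ l))))))

dihedral-↔ : Fin 2 → Fin 5 → Fin 5 ↔ Fin 5
dihedral-↔ s r = mk↔ₛ′ (dihedral s r) (λ k → proj₁ (dihedral-onto s r k)) (λ k → proj₂ (dihedral-onto s r k))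
  λ k → dihedral-injective s r _ k (proj₂ (dihedral-onto s r (dihedral s r k)))

mirror-↔ : Fin 5 ↔ Fin 5
mirror-↔ = mk↔ₛ′ mirror mirror involutive involutive
  where
  involutive : ∀ k → mirror (mirror k) ≡ k
  involutive 0F = refl
  involutive 1F = refl
  involutive 2F = refl
  involutive 3F = refl
  involutive 4F = refl

record Labelling (G C : SimpleGraph 5) : Set where
  field
    lab   : Fin 5 ↔ Fin 5
    C-std : ∀ i j → SimpleGraph.adj C (Inverse.to lab i) (Inverse.to lab j) ≡ stdC i j
    a02   : Adj G (Inverse.to lab 0F) (Inverse.to lab 2F)
    a03   : Adj G (Inverse.to lab 0F) (Inverse.to lab 3F)
    a13   : Adj G (Inverse.to lab 1F) (Inverse.to lab 3F)

module _ (G C : SimpleGraph 5) where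

  Adj-irrefl : ∀ {x y} → Adj G x y → x ≢ y
  Adj-irrefl {x} a refl with trans (sym a) (SimpleGraph.loopless G x)
  ... | ()

  Adj-sym : ∀ {x y} → Adj G x y → Adj G y x
  Adj-sym {x} {y} a = trans (SimpleGraph.symm G y x) a

  abstract

    ¬P2⇒K4P4 : ¬ P2 G C → ∃ λ a → ∃ λ b → ∃ λ c → ∃ λ d → InducesK4P4 G C a b c d
    ¬P2⇒K4P4 ¬p2 = decidable-stable (any? λ a → any? λ b → any? λ c → any? λ d → induces? a b c d)
      λ none → ¬p2 λ a b c d h → none (a , b , c , d , h)
      where
      adj? : ∀ (H : SimpleGraph 5) x y → Dec (Adj H x y)
      adj? H x y = SimpleGraph.adj H x y Bool.≟ true
      induces? : ∀ a b c d → Dec (InducesK4P4 G C a b c d)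
      induces? a b c d =
        (adj? G a b ×-dec adj? G a c ×-dec adj? G a d ×-dec adj? G b c ×-dec adj? G b d ×-dec adj? G c d) ×-dec
        (adj? C a b ×-dec adj? C b c ×-dec adj? C c d ×-dec ¬? (adj? C a c) ×-dec ¬? (adj? C b d) ×-dec ¬? (adj? C a d))

  labelling : HamCycle5 C → ¬ P2 G C → Labelling G C
  labelling (lab , C-std) ¬p2 with ¬P2⇒K4P4 ¬p2
  ... | a , b , c , d , (_ , ac , ad , _ , bd , _) , (ab , bc , cd , _)
    with dihedral-path (from a) (from b) (from c) (from d)
           (cycle ab) (cycle bc) (cycle cd) (distinct (Adj-irrefl ac)) (distinct (Adj-irrefl bd))
    where
    open Inverse lab
    inv : ∀ x → to (from x) ≡ x
    inv = strictlyInverseˡ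
    cycle : ∀ {x y} → Adj C x y → stdC (from x) (from y) ≡ true
    cycle {x} {y} e = trans (sym (C-std (from x) (from y))) (trans (cong₂ (SimpleGraph.adj C) (inv x) (inv y)) e)
    distinct : ∀ {x y} → x ≢ y → from x ≢ from y
    distinct x≢y eq = x≢y (trans (sym (inv _)) (trans (cong to eq) (inv _)))
  ... | s , r , p0 , p1 , p2 , p3 = record
    { lab   = lab ↔-∘ dihedral-↔ s r
    ; C-std = λ i j → trans (C-std _ _) (dihedral-cycle s r i j)
    ; a02   = subst₂ (Adj G) (sym (place p0)) (sym (place p2)) ac
    ; a03   = subst₂ (Adj G) (sym (place p0)) (sym (place p3)) ad
    ; a13   = subst₂ (Adj G) (sym (place p1)) (sym (place p3)) bd
    }
    where
    place : ∀ {k x} → dihedral s r k ≡ Inverse.from lab x → Inverse.to lab (dihedral s r k) ≡ x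
    place {x = x} eq = trans (cong (Inverse.to lab) eq) (Inverse.strictlyInverseˡ lab x)

  mirror-labelling : Labelling G C → Labelling G C
  mirror-labelling L = record
    { lab   = lab ↔-∘ mirror-↔
    ; C-std = λ i j → trans (C-std (mirror i) (mirror j)) (mirror-cycle i j)
    ; a02   = Adj-sym a13 ; a03 = Adj-sym a03 ; a13 = Adj-sym a02 }
    where
    open Labelling L
    mirror-cycle : ∀ i j → stdC (mirror i) (mirror j) ≡ stdC i j
    mirror-cycle = dihedral-cycle 1F 0F

  module _ (C⊆G : ∀ u v → Adj C u v → Adj G u v) where

    -- Only the chords at 4 are undecided: the edge between `h₁` and `h₂` lies on the paths 1 and 4,
    -- and `apart24` excludes 24.
    skeleton⇒G-std : (L : Labelling G C) → let open Labelling L in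
      ∀ R → Represents G C R →
      Structure.Skeleton (Rep.T R) (Labelled.Q G C lab C-std R) →
      ∀ i j → SimpleGraph.adj G (Inverse.to lab i) (Inverse.to lab j) ≡ stdG i j
    skeleton⇒G-std L R rep sk = table
      where
      open Labelling L
      open Labelled G C lab C-std
      open Structure.Skeleton sk using (h₁; h₂; 1h; 4h; apart24)
      g : Fin 5 → Fin 5 → Bool
      g i j = SimpleGraph.adj G (Inverse.to lab i) (Inverse.to lab j)
      flip : ∀ i j {b} → g i j ≡ b → g j i ≡ b
      flip i j = trans (SimpleGraph.symm G _ _)
      loop : ∀ i → g i i ≡ false
      loop i = SimpleGraph.loopless G _
      cycle : ∀ i j → stdC i j ≡ true → g i j ≡ true
      cycle i j c = C⊆G _ _ (trans (C-std i j) c)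
      a14 : g 1F 4F ≡ true
      a14 = meet⇒adjacent R rep 1F 4F (λ ()) (h₁ , h₂ , 1h , 4h)
      a24 : g 2F 4F ≡ false
      a24 with g 2F 4F in eq
      ... | false = refl
      ... | true  = contradiction (adjacent⇒meet R rep 2F 4F (λ ()) eq) apart24
      table : ∀ i j → g i j ≡ stdG i j
      table 0F 0F = loop 0F
      table 0F 1F = cycle 0F 1F refl
      table 0F 2F = a02
      table 0F 3F = a03
      table 0F 4F = cycle 0F 4F refl
      table 1F 0F = cycle 1F 0F refl
      table 1F 1F = loop 1F
      table 1F 2F = cycle 1F 2F refl
      table 1F 3F = a13
      table 1F 4F = a14
      table 2F 0F = flip 0F 2F a02
      table 2F 1F = cycle 2F 1F refl
      table 2F 2F = loop 2F
      table 2F 3F = cycle 2F 3F refl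
      table 2F 4F = a24
      table 3F 0F = flip 0F 3F a03
      table 3F 1F = flip 1F 3F a13
      table 3F 2F = cycle 3F 2F refl
      table 3F 3F = loop 3F
      table 3F 4F = cycle 3F 4F refl
      table 4F 0F = cycle 4F 0F refl
      table 4F 1F = flip 1F 4F a14
      table 4F 2F = flip 2F 4F a24
      table 4F 3F = cycle 4F 3F refl
      table 4F 4F = loop 4F

    -- The induced path in the K₄ fixes the labelling only up to `mirror`. Which of the chords 14
    -- and 24 is missing depends on where the paths 0 and 3 split, so the representation decides
    -- between the two labellings.
    standard-labelling : Labelling G C → ∀ R → Represents G C R →
      Σ (Labelling G C) λ L → let open Labelling L in
        ∀ i j → SimpleGraph.adj G (Inverse.to lab i) (Inverse.to lab j) ≡ stdG i j
    standard-labelling L R rep =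
      [ (λ sk → L , skeleton⇒G-std L R rep sk)
      , (λ sk → mirror-labelling L , skeleton⇒G-std (mirror-labelling L) R rep sk)
      ]′ (pentagon⇒skeleton (Labelled.pentagon G C lab C-std R rep a02 a03 a13))
      where
      open Labelling L
      open Structure (Rep.T R)

theorem6 : (G C : SimpleGraph 5) →
    (∀ u v → Adj C u v → Adj G u v) →
    HamCycle5 C →
    (∃ λ (R : Rep 5) → Represents G C R) →
    ¬ P2 G C →
    Σ (Fin 5 ↔ Fin 5) λ lab →
    (∀ i j → SimpleGraph.adj C (Inverse.to lab i) (Inverse.to lab j) ≡ stdC i j) ×
    (∀ i j → SimpleGraph.adj G (Inverse.to lab i) (Inverse.to lab j) ≡ stdG i j) ×
    (∃ λ (R : Rep 5) → Represents G C R × Minimal G C R × IsStd lab R) ×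
    (∀ (R : Rep 5) → Represents G C R → Minimal G C R → IsStd lab R)
theorem6 G C C⊆G ham (R , rep) ¬p2 =
  let (L , G-std) = standard-labelling G C C⊆G (labelling G C ham ¬p2) R rep
      open Labelling L
      open Labelled.Standard G C lab C-std G-std
  in lab , C-std , G-std , existence R rep , uniqueness
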